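{- Let $k\ge 3$. Among all relaxations of the $k$-way cut problem based on embeddings in the simplex that minimize the volume measured by some norm (without adding other constraints), the (scaled) $L_1$ norm has the smallest possible integrality gap. That is: for every norm $\|\cdot\|'$ on $\mathbb{R}^k$ for which minimizing $\mathrm{vol}_{\|\cdot\|'}$ is a relaxation of the $k$-way cut problem, the integrality gap of the relaxation given by $\|\cdot\|'$ is at least the integrality gap of the relaxation given by the norm $|\cdot| = \tfrac12\|\cdot\|_1$.
   Context: Let $\Delta=\{x\in\mathbb{R}^k : x\ge 0,\ \sum_i x_i=1\}$; its $i$-th vertex is the point with $x_i=1$. An instance is a finite undirected graph $G$ with nonnegative edge costs and $k$ distinguished nodes, terminals $1,\dots,k$. A $k$-way cut of $G$ is a set of edges whose removal disconnects each terminal from all the others; its cost is the sum of its edge costs. An embedding of $G$ is a map $\phi$ from the nodes of $G$ to $\Delta$ sending terminal $i$ to the $i$-th vertex of $\Delta$. For a norm $N$ on $\mathbb{R}^k$, the volume of the embedding is $\mathrm{vol}_N=\sum_{uv}\mathrm{cost}(uv)\,N(\phi(u)-\phi(v))$, summed over edges $uv$ of $G$. Minimizing $\mathrm{vol}_N$ over embeddings is a relaxation of $k$-way cut if for every instance the minimum volume is at most the minimum cost of a $k$-way cut (equivalently, any two vertices of $\Delta$ are at $N$-distance at most $1$). The integrality gap of the relaxation given by $N$ is the supremum, over all instances $G$ (with positive minimum volume), of the minimum cost of a $k$-way cut of $G$ divided by the minimum of $\mathrm{vol}_N$ over embeddings of $G$. -}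

module Defs where

import Algebra.Properties.Group as GroupProperties
open import Level using (0ℓ)
open import Data.Bool.Base using (if_then_else_)
open import Data.Fin.Base as Fin using (Fin)
import Data.Fin.Properties as Fin
open import Data.Fin.Subset using (Subset; _∉_)
open import Data.Nat.Base as ℕ using (ℕ; _⊔_)
import Data.Nat.Properties as ℕ
open import Data.Product.Base using (Σ; _×_; _,_; proj₁; proj₂; ∃; ∃-syntax)
open import Data.Rational.Base hiding (_⊔_; truncate)
open import Data.Rational.Properties
open import Data.Vec.Base using (lookup)
open import Data.Vec.Functional using (Vector; foldr)
open import Function.Base using (case_of_)
open import Function.Definitions using (Injective)
open import Relation.Binary.Construct.Closure.Equivalence using (EqClosure)
open import Relation.Binary.PropositionalEquality using (_≡_; _≢_; refl; sym; trans; cong; cong₂; subst)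
open import Relation.Nullary.Decidable.Core using (does)
open import Relation.Nullary.Negation.Core using (¬_)
open import Relation.Unary using (Pred)

-- Real numbers: Cauchy sequences of rationals, considered up to _≈ℝ_.

Cauchy : (ℕ → ℚ) → Set
Cauchy x = ∀ ε → 0ℚ < ε →
  ∃[ M ] (∀ m n → M ℕ.≤ m → M ℕ.≤ n → ∣ x m - x n ∣ < ε)

record ℝ : Set where
  constructor mkℝ
  field
    seq    : ℕ → ℚ
    cauchy : Cauchy seq

open ℝ public

infix 4 _≈ℝ_ _≤ℝ_ _<ℝ_

_≈ℝ_ : ℝ → ℝ → Set
x ≈ℝ y = ∀ ε → 0ℚ < ε → ∃[ M ] (∀ n → M ℕ.≤ n → ∣ seq x n - seq y n ∣ < ε)

_≤ℝ_ : ℝ → ℝ → Set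
x ≤ℝ y = ∀ ε → 0ℚ < ε → ∃[ M ] (∀ n → M ℕ.≤ n → seq x n < seq y n + ε)

_<ℝ_ : ℝ → ℝ → Set
x <ℝ y = ∃[ ε ] (0ℚ < ε × ∃[ M ] (∀ n → M ℕ.≤ n → seq x n + ε < seq y n))

module CauchyLemmas where

  -- Abstract because unfolding these proofs makes type checking explode.
  abstract

    flip-sub : ∀ a b → - (a - b) ≡ b - a
    flip-sub = GroupProperties.⁻¹-anti-homo-// +-0-group

    sub-add : ∀ a b → (a - b) + b ≡ a
    sub-add a b = GroupProperties.//-rightDividesˡ +-0-group b a

    add-sub : ∀ a b → (a + b) - b ≡ a
    add-sub a b = GroupProperties.//-rightDividesʳ +-0-group b a

    sub-interchange : ∀ a b c d → (a + b) - (c + d) ≡ (a - c) + (b - d)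
    sub-interchange a b c d = trans (cong (a + b +_) (neg-distrib-+ c d))
      (trans (+-assoc a b (- c + - d))
        (trans (cong (a +_) (trans (sym (+-assoc b (- c) (- d)))
          (trans (cong (_- d) (+-comm b (- c))) (+-assoc (- c) b (- d)))))
            (sym (+-assoc a (- c) (b - d)))))

    *-distribˡ-sub : ∀ a b c → a * (b - c) ≡ a * b - a * c
    *-distribˡ-sub a b c =
      trans (*-distribˡ-+ a b (- c)) (cong (a * b +_) (sym (neg-distribʳ-* a c)))

    sub-telescope : ∀ a b c → (a - b) + (b - c) ≡ a - c
    sub-telescope a b c = trans (sym (+-assoc (a - b) b (- c))) (cong (_- c) (sub-add a b))

    mul-sub : ∀ a b c d → a * b - c * d ≡ a * (b - d) + d * (a - c)
    mul-sub a b c d = sym (trans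
      (cong₂ _+_ (*-distribˡ-sub a b d)
                 (trans (*-distribˡ-sub d a c) (cong₂ _-_ (*-comm d a) (*-comm d c))))
      (sub-telescope (a * b) (a * d) (c * d)))

    half+half : ∀ ε → ½ * ε + ½ * ε ≡ ε
    half+half ε = trans (sym (*-distribʳ-+ ε ½ ½)) (*-identityˡ ε)

    0<half : ∀ {ε} → 0ℚ < ε → 0ℚ < ½ * ε
    0<half {ε} 0<ε = subst (_< ½ * ε) (*-zeroʳ ½) (*-monoʳ-<-pos ½ 0<ε)

    const-cauchy : ∀ q → Cauchy (λ _ → q)
    const-cauchy q ε 0<ε = 0 , λ _ _ _ _ →
      subst (_< ε) (sym (cong ∣_∣ (+-inverseʳ q))) 0<ε

    +-cauchy : ∀ x y → Cauchy x → Cauchy y → Cauchy (λ n → x n + y n)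
    +-cauchy x y cx cy ε 0<ε
      with (M , p) ← cx (½ * ε) (0<half 0<ε) | (L , q) ← cy (½ * ε) (0<half 0<ε) =
      M ⊔ L , λ m n hm hn → begin-strict
        ∣ (x m + y m) - (x n + y n) ∣     ≡⟨ cong ∣_∣ (sub-interchange (x m) (y m) (x n) (y n)) ⟩
        ∣ (x m - x n) + (y m - y n) ∣     ≤⟨ ∣p+q∣≤∣p∣+∣q∣ (x m - x n) (y m - y n) ⟩
        ∣ x m - x n ∣ + ∣ y m - y n ∣     <⟨ +-mono-<
          (p m n (ℕ.m⊔n≤o⇒m≤o M L hm) (ℕ.m⊔n≤o⇒m≤o M L hn))
          (q m n (ℕ.m⊔n≤o⇒n≤o M L hm) (ℕ.m⊔n≤o⇒n≤o M L hn)) ⟩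
        ½ * ε + ½ * ε                     ≡⟨ half+half ε ⟩
        ε                                 ∎
      where
      open ≤-Reasoning

    neg-cauchy : ∀ x → Cauchy x → Cauchy (λ n → - x n)
    neg-cauchy x cx ε 0<ε with (M , p) ← cx ε 0<ε =
      M , λ m n hm hn → subst (_< ε) (eq (x m) (x n)) (p m n hm hn)
      where
      eq : ∀ a b → ∣ a - b ∣ ≡ ∣ - a - - b ∣
      eq a b = trans (sym (∣-p∣≡∣p∣ (a - b))) (cong ∣_∣ (neg-distrib-+ a (- b)))

    ∣∣a∣-∣b∣∣≤∣a-b∣ : ∀ a b → ∣ ∣ a ∣ - ∣ b ∣ ∣ ≤ ∣ a - b ∣
    ∣∣a∣-∣b∣∣≤∣a-b∣ a b = case ∣p∣≡p∨∣p∣≡-p (∣ a ∣ - ∣ b ∣) of λ where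
        (inj₁ eq) → subst (_≤ ∣ a - b ∣) (sym eq) (below a b)
        (inj₂ eq) → subst (_≤ ∣ a - b ∣) (sym (trans eq (flip-sub ∣ a ∣ ∣ b ∣)))
                      (subst (∣ b ∣ - ∣ a ∣ ≤_) (trans (cong ∣_∣ (sym (flip-sub a b))) (∣-p∣≡∣p∣ (a - b))) (below b a))
      where
      open import Data.Sum.Base using (inj₁; inj₂)
      below : ∀ a b → ∣ a ∣ - ∣ b ∣ ≤ ∣ a - b ∣
      below a b = begin
        ∣ a ∣ - ∣ b ∣                 ≡⟨ cong (λ t → ∣ t ∣ - ∣ b ∣) (sym (sub-add a b)) ⟩
        ∣ (a - b) + b ∣ - ∣ b ∣       ≤⟨ +-monoˡ-≤ (- ∣ b ∣) (∣p+q∣≤∣p∣+∣q∣ (a - b) b) ⟩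
        (∣ a - b ∣ + ∣ b ∣) - ∣ b ∣   ≡⟨ add-sub ∣ a - b ∣ ∣ b ∣ ⟩
        ∣ a - b ∣                     ∎
        where open ≤-Reasoning

    abs-cauchy : ∀ x → Cauchy x → Cauchy (λ n → ∣ x n ∣)
    abs-cauchy x cx ε 0<ε with (M , p) ← cx ε 0<ε =
      M , λ m n hm hn → ≤-<-trans (∣∣a∣-∣b∣∣≤∣a-b∣ (x m) (x n)) (p m n hm hn)

    eventually-bounded : ∀ x → Cauchy x →
      ∃[ B ] (Positive B × ∃[ M ] (∀ n → M ℕ.≤ n → ∣ x n ∣ ≤ B))
    eventually-bounded x cx with (M , p) ← cx 1ℚ (positive⁻¹ 1ℚ) =
      1ℚ + ∣ x M ∣ , pos+nonNeg⇒pos 1ℚ ∣ x M ∣ {{nonNegative (0≤∣p∣ (x M))}} , M , λ n hn → begin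
        ∣ x n ∣                    ≡⟨ cong ∣_∣ (sym (sub-add (x n) (x M))) ⟩
        ∣ (x n - x M) + x M ∣      ≤⟨ ∣p+q∣≤∣p∣+∣q∣ (x n - x M) (x M) ⟩
        ∣ x n - x M ∣ + ∣ x M ∣    ≤⟨ +-monoˡ-≤ ∣ x M ∣ (<⇒≤ (p n M hn ℕ.≤-refl)) ⟩
        1ℚ + ∣ x M ∣               ∎
      where
      open ≤-Reasoning

    divide : ∀ D → Positive D → ∀ ε → 0ℚ < ε → ∃[ δ ] (0ℚ < δ × D * δ ≡ ε)
    divide D D>0 ε 0<ε =
      1/ D * ε
      , subst (_< 1/ D * ε) (*-zeroʳ (1/ D)) (*-monoʳ-<-pos (1/ D) {{1/pos⇒pos D}} 0<ε)
      , trans (sym (*-assoc D (1/ D) ε))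
          (trans (cong (_* ε) (*-inverseʳ D)) (*-identityˡ ε))
      where
      instance
        D-pos : Positive D
        D-pos = D>0
        D≢0 : NonZero D
        D≢0 = pos⇒nonZero D

    ∣a*b∣≤K*∣b∣ : ∀ {K} a b → ∣ a ∣ ≤ K → ∣ a * b ∣ ≤ K * ∣ b ∣
    ∣a*b∣≤K*∣b∣ {K} a b h = subst (_≤ K * ∣ b ∣) (sym (∣p*q∣≡∣p∣*∣q∣ a b))
      (*-monoʳ-≤-nonNeg ∣ b ∣ {{nonNegative (0≤∣p∣ b)}} h)

    ∣ab-cd∣<ε : ∀ {B C δ ε} a b c d → Positive B → Positive C → (B + C) * δ ≡ ε →
      ∣ a ∣ ≤ B → ∣ d ∣ ≤ C → ∣ a - c ∣ < δ → ∣ b - d ∣ < δ → ∣ a * b - c * d ∣ < ε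
    ∣ab-cd∣<ε {B} {C} {δ} {ε} a b c d B>0 C>0 eq ha hd hac hbd = begin-strict
      ∣ a * b - c * d ∣                      ≡⟨ cong ∣_∣ (mul-sub a b c d) ⟩
      ∣ a * (b - d) + d * (a - c) ∣          ≤⟨ ∣p+q∣≤∣p∣+∣q∣ (a * (b - d)) (d * (a - c)) ⟩
      ∣ a * (b - d) ∣ + ∣ d * (a - c) ∣      ≤⟨ +-mono-≤ (∣a*b∣≤K*∣b∣ a (b - d) ha) (∣a*b∣≤K*∣b∣ d (a - c) hd) ⟩
      B * ∣ b - d ∣ + C * ∣ a - c ∣          <⟨ +-mono-< (*-monoʳ-<-pos B {{B>0}} hbd) (*-monoʳ-<-pos C {{C>0}} hac) ⟩
      B * δ + C * δ                          ≡⟨ sym (*-distribʳ-+ δ B C) ⟩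
      (B + C) * δ                            ≡⟨ eq ⟩
      ε                                      ∎
      where open ≤-Reasoning

    *-cauchy : ∀ x y → Cauchy x → Cauchy y → Cauchy (λ n → x n * y n)
    *-cauchy x y cx cy ε 0<ε =
      let B , B>0 , M₁ , bx = eventually-bounded x cx
          C , C>0 , M₂ , by = eventually-bounded y cy
          δ , 0<δ , eq      = divide (B + C) (pos+pos⇒pos B {{B>0}} C {{C>0}}) ε 0<ε
          M₃ , p            = cx δ 0<δ
          M₄ , q            = cy δ 0<δ
          l : ∀ i → (M₁ ⊔ M₂) ⊔ (M₃ ⊔ M₄) ℕ.≤ i → M₁ ⊔ M₂ ℕ.≤ i
          l i h = ℕ.m⊔n≤o⇒m≤o (M₁ ⊔ M₂) (M₃ ⊔ M₄) h
          r : ∀ i → (M₁ ⊔ M₂) ⊔ (M₃ ⊔ M₄) ℕ.≤ i → M₃ ⊔ M₄ ℕ.≤ i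
          r i h = ℕ.m⊔n≤o⇒n≤o (M₁ ⊔ M₂) (M₃ ⊔ M₄) h
      in (M₁ ⊔ M₂) ⊔ (M₃ ⊔ M₄) , λ m n hm hn →
        ∣ab-cd∣<ε (x m) (y m) (x n) (y n) B>0 C>0 eq
          (bx m (ℕ.m⊔n≤o⇒m≤o M₁ M₂ (l m hm)))
          (by n (ℕ.m⊔n≤o⇒n≤o M₁ M₂ (l n hn)))
          (p m n (ℕ.m⊔n≤o⇒m≤o M₃ M₄ (r m hm)) (ℕ.m⊔n≤o⇒m≤o M₃ M₄ (r n hn)))
          (q m n (ℕ.m⊔n≤o⇒n≤o M₃ M₄ (r m hm)) (ℕ.m⊔n≤o⇒n≤o M₃ M₄ (r n hn)))

open CauchyLemmas

infixl 6 _+ℝ_ _-ℝ_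
infixl 7 _*ℝ_
infix  8 -ℝ_

fromℚ : ℚ → ℝ
fromℚ q = mkℝ (λ _ → q) (const-cauchy q)

0ℝ 1ℝ : ℝ
0ℝ = fromℚ 0ℚ
1ℝ = fromℚ 1ℚ

_+ℝ_ _*ℝ_ : ℝ → ℝ → ℝ
x +ℝ y = mkℝ (λ n → seq x n + seq y n) (+-cauchy (seq x) (seq y) (cauchy x) (cauchy y))
x *ℝ y = mkℝ (λ n → seq x n * seq y n) (*-cauchy (seq x) (seq y) (cauchy x) (cauchy y))

-ℝ_ : ℝ → ℝ
-ℝ x = mkℝ (λ n → - seq x n) (neg-cauchy (seq x) (cauchy x))

_-ℝ_ : ℝ → ℝ → ℝ
x -ℝ y = x +ℝ (-ℝ y)

∣_∣ℝ : ℝ → ℝ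
∣ x ∣ℝ = mkℝ (λ n → ∣ seq x n ∣) (abs-cauchy (seq x) (cauchy x))

sumℝ : ∀ {n} → Vector ℝ n → ℝ
sumℝ = foldr _+ℝ_ 0ℝ

IsMinimum : Pred ℝ 0ℓ → ℝ → Set
IsMinimum P m = P m × (∀ x → P x → m ≤ℝ x)

IsInfimum : Pred ℝ 0ℓ → ℝ → Set
IsInfimum P m = (∀ x → P x → m ≤ℝ x) × (∀ l → (∀ x → P x → l ≤ℝ x) → l ≤ℝ m)

-- Extended reals [-∞,+∞] as lower Dedekind cuts: a number is given by the
-- rationals strictly below it (none for -∞, all for +∞).  In this form every
-- set of reals has a supremum without appeal to excluded middle.

record ℝ∞ : Set₁ where
  field
    Below       : ℚ → Set
    down-closed : ∀ {p q} → p < q → Below q → Below p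
    rounded     : ∀ {p} → Below p → ∃[ q ] (p < q × Below q)

open ℝ∞ public

infix 4 _≤∞_

_≤∞_ : ℝ∞ → ℝ∞ → Set
g ≤∞ h = ∀ q → Below g q → Below h q

sup : Pred ℝ 0ℓ → ℝ∞
sup P = record
  { Below       = λ q → ∃[ x ] (P x × fromℚ q <ℝ x)
  ; down-closed = λ { p<q (x , Px , ε , 0<ε , M , h) →
      x , Px , ε , 0<ε , M , λ n hn → <-trans (+-monoˡ-< ε p<q) (h n hn) }
  ; rounded     = λ { {p} (x , Px , ε , 0<ε , M , h) →
      p + ½ * ε
      , subst (_< p + ½ * ε) (+-identityʳ p) (+-monoʳ-< p (0<half 0<ε))
      , x , Px , ½ * ε , 0<half 0<ε , M , λ n hn →
          subst (_< seq x n) (sym (trans (+-assoc p (½ * ε) (½ * ε)) (cong (p +_) (half+half ε)))) (h n hn) }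
  }

infix  4 _≈ᵛ_
infixl 6 _+ᵛ_ _-ᵛ_
infixr 7 _·ᵛ_

_≈ᵛ_ : ∀ {k} → Vector ℝ k → Vector ℝ k → Set
x ≈ᵛ y = ∀ i → x i ≈ℝ y i

_+ᵛ_ _-ᵛ_ : ∀ {k} → Vector ℝ k → Vector ℝ k → Vector ℝ k
(x +ᵛ y) i = x i +ℝ y i
(x -ᵛ y) i = x i -ℝ y i

_·ᵛ_ : ∀ {k} → ℝ → Vector ℝ k → Vector ℝ k
(a ·ᵛ x) i = a *ℝ x i

record IsNorm {k : ℕ} (N : Vector ℝ k → ℝ) : Set where
  field
    respects    : ∀ (x y : Vector ℝ k) → x ≈ᵛ y → N x ≈ℝ N y
    N≥0         : ∀ (x : Vector ℝ k) → 0ℝ ≤ℝ N x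
    -- "x ≠ 0 implies N x > 0", with x ≠ 0 read as: some coordinate is nonzero.
    definite    : ∀ (x : Vector ℝ k) → (∃ λ (i : Fin k) → 0ℝ <ℝ ∣ x i ∣ℝ) → 0ℝ <ℝ N x
    homogeneous : ∀ (a : ℝ) (x : Vector ℝ k) → N (a ·ᵛ x) ≈ℝ (∣ a ∣ℝ *ℝ N x)
    triangle    : ∀ (x y : Vector ℝ k) → N (x +ᵛ y) ≤ℝ (N x +ℝ N y)

½L₁ : ∀ {k} → Vector ℝ k → ℝ
½L₁ x = fromℚ ½ *ℝ sumℝ (λ i → ∣ x i ∣ℝ)

InSimplex : ∀ {k} → Vector ℝ k → Set
InSimplex x = (∀ i → 0ℝ ≤ℝ x i) × sumℝ x ≈ℝ 1ℝ

vertex : ∀ {k} → Fin k → Vector ℝ k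
vertex i j = if does (i Fin.≟ j) then 1ℝ else 0ℝ

-- A finite simple graph: the edge {u , v} is stored as the pair (u , v) with
-- u < v, and distinct edges have distinct pairs of endpoints.
record Instance (k : ℕ) : Set where
  field
    nodes edges        : ℕ
    ends               : Fin edges → Fin nodes × Fin nodes
    ends-ordered       : ∀ e → proj₁ (ends e) Fin.< proj₂ (ends e)
    ends-injective     : Injective _≡_ _≡_ ends
    cost               : Fin edges → ℝ
    cost-nonNegative   : ∀ e → 0ℝ ≤ℝ cost e
    terminal           : Fin k → Fin nodes
    terminal-injective : Injective _≡_ _≡_ terminal

module _ {k : ℕ} (G : Instance k) where
  open Instance G

  AdjacentWithout : Subset edges → Fin nodes → Fin nodes → Set
  AdjacentWithout S u v = ∃[ e ] (e ∉ S × ends e ≡ (u , v))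

  ConnectedWithout : Subset edges → Fin nodes → Fin nodes → Set
  ConnectedWithout S = EqClosure (AdjacentWithout S)

  IsCut : Subset edges → Set
  IsCut S = ∀ i j → i ≢ j → ¬ ConnectedWithout S (terminal i) (terminal j)

  cutCost : Subset edges → ℝ
  cutCost S = sumℝ (λ e → if lookup S e then cost e else 0ℝ)

  CutCosts : Pred ℝ 0ℓ
  CutCosts c = ∃[ S ] (IsCut S × cutCost S ≈ℝ c)

  record Embedding : Set where
    field
      φ          : Fin nodes → Vector ℝ k
      φ-simplex  : ∀ u → InSimplex (φ u)
      φ-terminal : ∀ i → φ (terminal i) ≈ᵛ vertex i

  vol : (Vector ℝ k → ℝ) → Embedding → ℝ
  vol N E = sumℝ (λ e → cost e *ℝ N (φ (proj₁ (ends e)) -ᵛ φ (proj₂ (ends e))))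
    where open Embedding E

  Volumes : (Vector ℝ k → ℝ) → Pred ℝ 0ℓ
  Volumes N v = ∃[ E ] (vol N E ≈ℝ v)

  IsMinCutCost : ℝ → Set
  IsMinCutCost = IsMinimum CutCosts

  -- The embeddings form a compact set on which vol N is continuous, so the
  -- minimum is the greatest lower bound; the latter exists constructively,
  -- whereas attainment does not.
  IsMinVolume : (Vector ℝ k → ℝ) → ℝ → Set
  IsMinVolume N = IsInfimum (Volumes N)

IsRelaxation : ∀ {k} → (Vector ℝ k → ℝ) → Set
IsRelaxation {k} N = ∀ (G : Instance k) v c →
  IsMinVolume G N v → IsMinCutCost G c → v ≤ℝ c

-- The quotient c / v, for v > 0, is the r with r v = c.
Ratios : ∀ {k} → (Vector ℝ k → ℝ) → Pred ℝ 0ℓ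
Ratios {k} N r = Σ (Instance k) λ G → ∃[ c ] ∃[ v ]
  (IsMinCutCost G c × IsMinVolume G N v × 0ℝ <ℝ v × r *ℝ v ≈ℝ c)

integralityGap : ∀ {k} → (Vector ℝ k → ℝ) → ℝ∞
integralityGap N = sup (Ratios N)

{-# OPTIONS --safe #-}

-- The same instance works for both norms.  A relaxation has N(eᵢ − eⱼ) ≤ 1, as
-- the instance with the single edge ij shows, and a difference of two points of
-- the simplex is a nonnegative combination of vectors eᵢ − eⱼ whose coefficients
-- add up to its ½L₁-norm.  Hence N ≤ ½L₁ on such differences, the minimum
-- N-volume is at most the minimum ½L₁-volume, and the ratio can only grow.
--
-- Constructively, the minimum N-volume has to be produced as a real number and
-- shown positive.  It is a limit of minima over finite nets of embeddings.  It is
-- positive because two terminals are joined by a path of edges of positive cost;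
-- this uses the definiteness of N only at some eᵢ − eⱼ, not the equivalence of norms.
module Submission where

open import Defs
open CauchyLemmas
open import Algebra.Bundles using (CommutativeRing)
import Algebra.Properties.Semiring.Sum as SemiringSum
import Algebra.Solver.Ring as RingSolver
open import Algebra.Solver.Ring.AlmostCommutativeRing using (AlmostCommutativeRing; fromCommutativeRing; _-Raw-AlmostCommutative⟶_)
open import Algebra.Structures using (IsCommutativeRing)
open import Data.Bool.Base using (true; false; if_then_else_)
open import Data.Fin.Base as Fin using (Fin; zero; suc; finToFun; funToFin)
import Data.Fin.Properties as Fin
open import Data.Fin.Subset using (inside; outside)
import Data.Integer.Base as ℤ
import Data.Integer.Properties as ℤ
open import Data.Maybe.Base using (Maybe; just; nothing)
open import Data.Nat.Base using (ℕ; _≤_)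
open import Data.Nat.Base as ℕ using (zero; suc)
import Data.Nat.Coprimality as ℕ
import Data.Nat.Properties as ℕ
open import Data.Product.Base using (Σ-syntax; _×_; _,_; proj₁; proj₂; ∃; ∃-syntax)
open import Data.Rational.Base as ℚ using (ℚ; 0ℚ; 1ℚ; ½; mkℚ)
import Data.Rational.Properties as ℚ
open import Data.Rational.Solver using () renaming (module +-*-Solver to Q)
import Data.Rational.Unnormalised.Base as ℚᵘ
import Data.Rational.Unnormalised.Properties as ℚᵘ
open import Data.Sum.Base using (_⊎_; inj₁; inj₂)
open import Data.Vec.Base using (lookup; []; _∷_; here)
open import Data.Vec.Functional using (Vector)
open import Function.Base using (_∘_; id)
open import Level using (0ℓ)
open import Relation.Binary.Bundles using (Poset)
import Relation.Binary.Construct.Closure.Equivalence as EqClosure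
open import Relation.Binary.Definitions using (tri<; tri≈; tri>)
open import Relation.Binary.PropositionalEquality as ≡ using (_≡_; _≢_; cong; cong₂; subst; subst₂)
import Relation.Binary.Reasoning.PartialOrder as PosetReasoning
open import Relation.Binary.Structures using (IsEquivalence)
open import Relation.Nullary.Decidable.Core using (Dec; yes; no; _×-dec_; ¬?)
open import Relation.Nullary.Negation.Core using (¬_; contradiction)
open import Relation.Unary using (Pred)

-- The coefficients come from a product coupling. If `P` and `M` are the positive and negative parts
-- of `d`, both of total `T`, then mass `Pᵢ Mⱼ / T` is moved between `i` and `j`. The division is
-- avoided by proving `T · N d ≤ T²`, because it cannot be decided whether `T` vanishes. The same
-- undecidability shapes the rest. A member of `Ratios` carries its minimum volume as a real number,
-- so a ratio for `½L₁` yields one for `N` only after that minimum has been constructed. Every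
-- choice on the way is made among rationals or among finitely many labels: a smallest value is
-- selected from rational approximations, a cost is only known to be at most `η` or at least `½ η`,
-- and terminals are compared by labels instead of by paths. Nets suffice because `N ≤ K · L₁`, with
-- `K` read off from the values of `N` at the vertices, makes the volume Lipschitz in the positions
-- of the nodes.

infix 4 _≈_ _≤ʳ_

-- Record versions of _≈ℝ_ and _≤ℝ_, from which Agda can infer the endpoints.
record _≈_ (x y : ℝ) : Set where
  constructor mk≈
  field un≈ : x ≈ℝ y
open _≈_

record _≤ʳ_ (x y : ℝ) : Set where
  constructor mk≤
  field un≤ : x ≤ℝ y
open _≤ʳ_

-- Cauchy reals as a commutative ring.

Eventually : (ℕ → Set) → Set
Eventually P = ∃[ M ] (∀ n → M ℕ.≤ n → P n)

eventually₂ : ∀ {P Q R : ℕ → Set} → (∀ n → P n → Q n → R n) →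
  Eventually P → Eventually Q → Eventually R
eventually₂ f (M , p) (L , q) = M ℕ.⊔ L , λ n h →
  f n (p n (ℕ.m⊔n≤o⇒m≤o M L h)) (q n (ℕ.m⊔n≤o⇒n≤o M L h))

always : ∀ {P : ℕ → Set} → (∀ n → P n) → Eventually P
always p = 0 , λ n _ → p n

abstract
  ≈-pointwise : ∀ {x y} → (∀ n → seq x n ≡ seq y n) → x ≈ y
  ≈-pointwise {x} {y} eq = mk≈ λ ε 0<ε → always λ n →
    subst (ℚ._< ε) (≡.sym (≡.trans (cong (λ t → ℚ.∣ t ℚ.- seq y n ∣) (eq n)) (cong ℚ.∣_∣ (ℚ.+-inverseʳ (seq y n))))) 0<ε

  ≤-eventually : ∀ {x y} → Eventually (λ n → seq x n ℚ.≤ seq y n) → x ≤ʳ y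
  ≤-eventually {x} {y} (M , le) = mk≤ λ ε 0<ε → M , λ n hn →
    ℚ.≤-<-trans (le n hn) (subst (ℚ._< seq y n ℚ.+ ε) (ℚ.+-identityʳ (seq y n)) (ℚ.+-monoʳ-< (seq y n) 0<ε))

  ≤-pointwise : ∀ {x y} → (∀ n → seq x n ℚ.≤ seq y n) → x ≤ʳ y
  ≤-pointwise le = ≤-eventually (always le)

  ∣a-b∣≡∣b-a∣ : ∀ a b → ℚ.∣ a ℚ.- b ∣ ≡ ℚ.∣ b ℚ.- a ∣
  ∣a-b∣≡∣b-a∣ a b = ≡.trans (≡.sym (ℚ.∣-p∣≡∣p∣ (a ℚ.- b))) (cong ℚ.∣_∣ (flip-sub a b))

  ≈-refl : ∀ {x} → x ≈ x
  ≈-refl = ≈-pointwise λ _ → ≡.refl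

  ≈-sym : ∀ {x y} → x ≈ y → y ≈ x
  ≈-sym {x} {y} (mk≈ h) = mk≈ λ ε 0<ε → let M , p = h ε 0<ε in
    M , λ n hn → subst (ℚ._< ε) (∣a-b∣≡∣b-a∣ (seq x n) (seq y n)) (p n hn)

  +-close : ∀ {ε} a b c d → ℚ.∣ a ℚ.- c ∣ ℚ.< ½ ℚ.* ε → ℚ.∣ b ℚ.- d ∣ ℚ.< ½ ℚ.* ε →
    ℚ.∣ (a ℚ.+ b) ℚ.- (c ℚ.+ d) ∣ ℚ.< ε
  +-close {ε} a b c d p q = begin-strict
    ℚ.∣ (a ℚ.+ b) ℚ.- (c ℚ.+ d) ∣        ≡⟨ cong ℚ.∣_∣ (sub-interchange a b c d) ⟩
    ℚ.∣ (a ℚ.- c) ℚ.+ (b ℚ.- d) ∣        ≤⟨ ℚ.∣p+q∣≤∣p∣+∣q∣ (a ℚ.- c) (b ℚ.- d) ⟩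
    ℚ.∣ a ℚ.- c ∣ ℚ.+ ℚ.∣ b ℚ.- d ∣      <⟨ ℚ.+-mono-< p q ⟩
    ½ ℚ.* ε ℚ.+ ½ ℚ.* ε                  ≡⟨ half+half ε ⟩
    ε                                    ∎
    where open ℚ.≤-Reasoning

  ≈-trans : ∀ {x y z} → x ≈ y → y ≈ z → x ≈ z
  ≈-trans {x} {y} {z} (mk≈ h) (mk≈ g) = mk≈ λ ε 0<ε → eventually₂
    (λ n p q → begin-strict
      ℚ.∣ seq x n ℚ.- seq z n ∣                                  ≡⟨ cong ℚ.∣_∣ (sub-telescope (seq x n) (seq y n) (seq z n)) ⟨
      ℚ.∣ (seq x n ℚ.- seq y n) ℚ.+ (seq y n ℚ.- seq z n) ∣      ≤⟨ ℚ.∣p+q∣≤∣p∣+∣q∣ (seq x n ℚ.- seq y n) (seq y n ℚ.- seq z n) ⟩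
      ℚ.∣ seq x n ℚ.- seq y n ∣ ℚ.+ ℚ.∣ seq y n ℚ.- seq z n ∣    <⟨ ℚ.+-mono-< p q ⟩
      ½ ℚ.* ε ℚ.+ ½ ℚ.* ε                                        ≡⟨ half+half ε ⟩
      ε                                                          ∎)
    (h (½ ℚ.* ε) (0<half 0<ε)) (g (½ ℚ.* ε) (0<half 0<ε))
    where open ℚ.≤-Reasoning

  +-cong : ∀ {x y u v} → x ≈ y → u ≈ v → x +ℝ u ≈ y +ℝ v
  +-cong {x} {y} {u} {v} (mk≈ h) (mk≈ g) = mk≈ λ ε 0<ε → eventually₂
    (λ n → +-close (seq x n) (seq u n) (seq y n) (seq v n))
    (h (½ ℚ.* ε) (0<half 0<ε)) (g (½ ℚ.* ε) (0<half 0<ε))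

  -- Since `xu − yv = x(u − v) + v(x − y)`, eventual bounds `B` on `x` and `C` on `v` reduce the
  -- claim to closeness within `δ`, where `(B + C) δ = ε`.
  *-cong : ∀ {x y u v} → x ≈ y → u ≈ v → x *ℝ u ≈ y *ℝ v
  *-cong {x} {y} {u} {v} (mk≈ h) (mk≈ g) = mk≈ λ ε 0<ε →
    let B , B>0 , bx = eventually-bounded (seq x) (cauchy x)
        C , C>0 , bv = eventually-bounded (seq v) (cauchy v)
        δ , 0<δ , eq = divide (B ℚ.+ C) (ℚ.pos+pos⇒pos B {{B>0}} C {{C>0}}) ε 0<ε
    in eventually₂
      (λ n (p , q) (r , s) → ∣ab-cd∣<ε (seq x n) (seq u n) (seq y n) (seq v n) B>0 C>0 eq p q r s)
      (eventually₂ (λ _ → _,_) bx bv) (eventually₂ (λ _ → _,_) (h δ 0<δ) (g δ 0<δ))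

  neg-cong : ∀ {x y} → x ≈ y → -ℝ x ≈ -ℝ y
  neg-cong {x} {y} (mk≈ h) = mk≈ λ ε 0<ε → let M , p = h ε 0<ε in M , λ n hn →
    subst (ℚ._< ε) (≡.trans (≡.sym (ℚ.∣-p∣≡∣p∣ (seq x n ℚ.- seq y n)))
      (cong ℚ.∣_∣ (ℚ.neg-distrib-+ (seq x n) (ℚ.- seq y n)))) (p n hn)

  ∣∣-cong : ∀ {x y} → x ≈ y → ∣ x ∣ℝ ≈ ∣ y ∣ℝ
  ∣∣-cong {x} {y} (mk≈ h) = mk≈ λ ε 0<ε → let M , p = h ε 0<ε in M , λ n hn →
    ℚ.≤-<-trans (∣∣a∣-∣b∣∣≤∣a-b∣ (seq x n) (seq y n)) (p n hn)

  ≈-isEquivalence : IsEquivalence _≈_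
  ≈-isEquivalence = record { refl = ≈-refl ; sym = ≈-sym ; trans = ≈-trans }

  +-*-isCommutativeRing : IsCommutativeRing _≈_ _+ℝ_ _*ℝ_ -ℝ_ 0ℝ 1ℝ
  +-*-isCommutativeRing = record
    { isRing = record
      { +-isAbelianGroup = record
        { isGroup = record
          { isMonoid = record
            { isSemigroup = record
              { isMagma = record { isEquivalence = ≈-isEquivalence ; ∙-cong = +-cong }
              ; assoc = λ x y z → ≈-pointwise λ n → ℚ.+-assoc (seq x n) (seq y n) (seq z n) }
            ; identity = (λ x → ≈-pointwise λ n → ℚ.+-identityˡ (seq x n))
                       , (λ x → ≈-pointwise λ n → ℚ.+-identityʳ (seq x n)) }
          ; inverse = (λ x → ≈-pointwise λ n → ℚ.+-inverseˡ (seq x n))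
                    , (λ x → ≈-pointwise λ n → ℚ.+-inverseʳ (seq x n))
          ; ⁻¹-cong = neg-cong }
        ; comm = λ x y → ≈-pointwise λ n → ℚ.+-comm (seq x n) (seq y n) }
      ; *-cong = *-cong
      ; *-assoc = λ x y z → ≈-pointwise λ n → ℚ.*-assoc (seq x n) (seq y n) (seq z n)
      ; *-identity = (λ x → ≈-pointwise λ n → ℚ.*-identityˡ (seq x n))
                   , (λ x → ≈-pointwise λ n → ℚ.*-identityʳ (seq x n))
      ; distrib = (λ x y z → ≈-pointwise λ n → ℚ.*-distribˡ-+ (seq x n) (seq y n) (seq z n))
                , (λ x y z → ≈-pointwise λ n → ℚ.*-distribʳ-+ (seq x n) (seq y n) (seq z n)) }
    ; *-comm = λ x y → ≈-pointwise λ n → ℚ.*-comm (seq x n) (seq y n) }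

ℝ-commutativeRing : CommutativeRing 0ℓ 0ℓ
ℝ-commutativeRing = record { isCommutativeRing = +-*-isCommutativeRing }

private
  ℝ-acr : AlmostCommutativeRing 0ℓ 0ℓ
  ℝ-acr = fromCommutativeRing ℝ-commutativeRing

  fromℚ-morphism : CommutativeRing.rawRing ℚ.+-*-commutativeRing -Raw-AlmostCommutative⟶ ℝ-acr
  fromℚ-morphism = record
    { ⟦_⟧ = fromℚ
    ; +-homo = λ p q → ≈-pointwise λ _ → ≡.refl
    ; *-homo = λ p q → ≈-pointwise λ _ → ≡.refl
    ; -‿homo = λ p → ≈-pointwise λ _ → ≡.refl
    ; 0-homo = ≈-refl
    ; 1-homo = ≈-refl
    }

  fromℚ-≟ : ∀ p q → Maybe (fromℚ p ≈ fromℚ q)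
  fromℚ-≟ p q with p ℚ.≟ q
  ... | yes ≡.refl = just ≈-refl
  ... | no _       = nothing

-- Coefficients are rationals, embedded by `fromℚ`: their equality is decidable, so the solver can
-- normalise constants such as `½`.
module ℝ-Solver = RingSolver (CommutativeRing.rawRing ℚ.+-*-commutativeRing) ℝ-acr fromℚ-morphism fromℚ-≟

open ℝ-Solver using (solve; _:=_; _:+_; _:*_; :-_; _:-_; con)

open CommutativeRing ℝ-commutativeRing
  using (+-assoc; +-comm; +-identityˡ; +-identityʳ; *-assoc; *-comm; *-identityˡ; *-identityʳ; zeroˡ; zeroʳ; distribˡ; distribʳ; +-congˡ; +-congʳ; *-congˡ; *-congʳ)
open SemiringSum (CommutativeRing.semiring ℝ-commutativeRing)
  using (*-distribˡ-sum; *-distribʳ-sum; sum-cong-≋; ∑-distrib-+; sum-replicate-zero)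

-- Order and absolute value.

p≤∣p∣ : ∀ p → p ℚ.≤ ℚ.∣ p ∣
p≤∣p∣ p with ℚ.≤-total 0ℚ p
... | inj₁ 0≤p = ℚ.≤-reflexive (≡.sym (ℚ.0≤p⇒∣p∣≡p 0≤p))
... | inj₂ p≤0 = ℚ.≤-trans p≤0 (ℚ.0≤∣p∣ p)

a<b+ε : ∀ {a b ε} → ℚ.∣ a ℚ.- b ∣ ℚ.< ε → a ℚ.< b ℚ.+ ε
a<b+ε {a} {b} {ε} h = begin-strict
  a                            ≡⟨ sub-add a b ⟨
  (a ℚ.- b) ℚ.+ b              ≤⟨ ℚ.+-monoˡ-≤ b (p≤∣p∣ (a ℚ.- b)) ⟩
  ℚ.∣ a ℚ.- b ∣ ℚ.+ b          <⟨ ℚ.+-monoˡ-< b h ⟩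
  ε ℚ.+ b                      ≡⟨ ℚ.+-comm ε b ⟩
  b ℚ.+ ε                      ∎
  where open ℚ.≤-Reasoning

a-b<ε : ∀ {a b ε} → a ℚ.< b ℚ.+ ε → a ℚ.- b ℚ.< ε
a-b<ε {a} {b} {ε} h = subst (a ℚ.- b ℚ.<_) (≡.trans (cong (ℚ._- b) (ℚ.+-comm b ε)) (add-sub ε b)) (ℚ.+-monoˡ-< (ℚ.- b) h)

+-cancelʳ-< : ∀ r p q → p ℚ.+ r ℚ.< q ℚ.+ r → p ℚ.< q
+-cancelʳ-< r p q h = subst₂ ℚ._<_ (add-sub p r) (add-sub q r) (ℚ.+-monoˡ-< (ℚ.- r) h)

∣a-b∣<ε : ∀ {a b ε} → a ℚ.< b ℚ.+ ε → b ℚ.< a ℚ.+ ε → ℚ.∣ a ℚ.- b ∣ ℚ.< ε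
∣a-b∣<ε {a} {b} {ε} p q with ℚ.∣p∣≡p∨∣p∣≡-p (a ℚ.- b)
... | inj₁ eq = subst (ℚ._< ε) (≡.sym eq) (a-b<ε {a} {b} p)
... | inj₂ eq = subst (ℚ._< ε) (≡.sym (≡.trans eq (flip-sub a b))) (a-b<ε {b} {a} q)

abstract
  ≈⇒≤ : ∀ {x y} → x ≈ y → x ≤ʳ y
  ≈⇒≤ {x} {y} (mk≈ h) = mk≤ λ ε 0<ε → let M , p = h ε 0<ε in M , λ n hn → a<b+ε {seq x n} {seq y n} (p n hn)

  ≤-trans : ∀ {x y z} → x ≤ʳ y → y ≤ʳ z → x ≤ʳ z
  ≤-trans {x} {y} {z} (mk≤ h) (mk≤ g) = mk≤ λ ε 0<ε → eventually₂
    (λ n p q → begin-strict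
      seq x n                                 <⟨ p ⟩
      seq y n ℚ.+ ½ ℚ.* ε                     <⟨ ℚ.+-monoˡ-< (½ ℚ.* ε) q ⟩
      (seq z n ℚ.+ ½ ℚ.* ε) ℚ.+ ½ ℚ.* ε       ≡⟨ ℚ.+-assoc (seq z n) _ _ ⟩
      seq z n ℚ.+ (½ ℚ.* ε ℚ.+ ½ ℚ.* ε)       ≡⟨ cong (seq z n ℚ.+_) (half+half ε) ⟩
      seq z n ℚ.+ ε                           ∎)
    (h (½ ℚ.* ε) (0<half 0<ε)) (g (½ ℚ.* ε) (0<half 0<ε))
    where open ℚ.≤-Reasoning

  ≤-antisym : ∀ {x y} → x ≤ʳ y → y ≤ʳ x → x ≈ y
  ≤-antisym {x} {y} (mk≤ h) (mk≤ g) = mk≈ λ ε 0<ε →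
    eventually₂ (λ n → ∣a-b∣<ε {seq x n} {seq y n}) (h ε 0<ε) (g ε 0<ε)

  +-mono-≤ : ∀ {x y u v} → x ≤ʳ y → u ≤ʳ v → x +ℝ u ≤ʳ y +ℝ v
  +-mono-≤ {x} {y} {u} {v} (mk≤ h) (mk≤ g) = mk≤ λ ε 0<ε → eventually₂
    (λ n p q → begin-strict
      seq x n ℚ.+ seq u n                                        <⟨ ℚ.+-mono-< p q ⟩
      (seq y n ℚ.+ ½ ℚ.* ε) ℚ.+ (seq v n ℚ.+ ½ ℚ.* ε)            ≡⟨ Q.solve 3 (λ y d v → (y Q.:+ d) Q.:+ (v Q.:+ d) Q.:= (y Q.:+ v) Q.:+ (d Q.:+ d)) ≡.refl (seq y n) (½ ℚ.* ε) (seq v n) ⟩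
      (seq y n ℚ.+ seq v n) ℚ.+ (½ ℚ.* ε ℚ.+ ½ ℚ.* ε)            ≡⟨ cong (seq y n ℚ.+ seq v n ℚ.+_) (half+half ε) ⟩
      (seq y n ℚ.+ seq v n) ℚ.+ ε                                ∎)
    (h (½ ℚ.* ε) (0<half 0<ε)) (g (½ ℚ.* ε) (0<half 0<ε))
    where open ℚ.≤-Reasoning

ℝ-poset : Poset 0ℓ 0ℓ 0ℓ
ℝ-poset = record
  { isPartialOrder = record
    { isPreorder = record { isEquivalence = ≈-isEquivalence ; reflexive = ≈⇒≤ ; trans = ≤-trans }
    ; antisym = ≤-antisym } }

module ≤-Reasoning = PosetReasoning ℝ-poset

≤-refl : ∀ {x} → x ≤ʳ x
≤-refl = ≈⇒≤ ≈-refl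

+-monoˡ-≤ : ∀ {x y} z → x ≤ʳ y → x +ℝ z ≤ʳ y +ℝ z
+-monoˡ-≤ z h = +-mono-≤ h ≤-refl

+-monoʳ-≤ : ∀ {x y} z → x ≤ʳ y → z +ℝ x ≤ʳ z +ℝ y
+-monoʳ-≤ z h = +-mono-≤ ≤-refl h

x≤y⇒0≤y-x : ∀ {x y} → x ≤ʳ y → 0ℝ ≤ʳ y -ℝ x
x≤y⇒0≤y-x {x} {y} h = begin
  0ℝ       ≈⟨ solve 1 (λ x → con 0ℚ := x :- x) ≈-refl x ⟩
  x -ℝ x   ≤⟨ +-monoˡ-≤ (-ℝ x) h ⟩
  y -ℝ x   ∎
  where open ≤-Reasoning

0≤y-x⇒x≤y : ∀ {x y} → 0ℝ ≤ʳ y -ℝ x → x ≤ʳ y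
0≤y-x⇒x≤y {x} {y} h = begin
  x               ≈⟨ +-identityˡ x ⟨
  0ℝ +ℝ x         ≤⟨ +-monoˡ-≤ x h ⟩
  (y -ℝ x) +ℝ x   ≈⟨ solve 2 (λ x y → y :- x :+ x := y) ≈-refl x y ⟩
  y               ∎
  where open ≤-Reasoning

fromℚ-mono-≤ : ∀ {p q} → p ℚ.≤ q → fromℚ p ≤ʳ fromℚ q
fromℚ-mono-≤ h = ≤-pointwise λ _ → h

0≤∣x∣ : ∀ x → 0ℝ ≤ʳ ∣ x ∣ℝ
0≤∣x∣ x = ≤-pointwise λ n → ℚ.0≤∣p∣ (seq x n)

∣x+y∣≤∣x∣+∣y∣ : ∀ x y → ∣ x +ℝ y ∣ℝ ≤ʳ ∣ x ∣ℝ +ℝ ∣ y ∣ℝ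
∣x+y∣≤∣x∣+∣y∣ x y = ≤-pointwise λ n → ℚ.∣p+q∣≤∣p∣+∣q∣ (seq x n) (seq y n)

∣x*y∣≈∣x∣*∣y∣ : ∀ x y → ∣ x *ℝ y ∣ℝ ≈ ∣ x ∣ℝ *ℝ ∣ y ∣ℝ
∣x*y∣≈∣x∣*∣y∣ x y = ≈-pointwise λ n → ℚ.∣p*q∣≡∣p∣*∣q∣ (seq x n) (seq y n)

∣-x∣≈∣x∣ : ∀ x → ∣ -ℝ x ∣ℝ ≈ ∣ x ∣ℝ
∣-x∣≈∣x∣ x = ≈-pointwise λ n → ℚ.∣-p∣≡∣p∣ (seq x n)

abstract
  -- A nonnegative real may have negative terms `a`, but eventually only with `− a < ½ ε`, and then
  -- `∣a∣ − a = − 2a < ε`.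
  0≤x⇒∣x∣≈x : ∀ {x} → 0ℝ ≤ʳ x → ∣ x ∣ℝ ≈ x
  0≤x⇒∣x∣≈x {x} (mk≤ h) = mk≈ λ ε 0<ε → let M , p = h (½ ℚ.* ε) (0<half 0<ε) in
    M , λ n hn → close (seq x n) 0<ε (p n hn)
    where
    close : ∀ {ε} a → 0ℚ ℚ.< ε → 0ℚ ℚ.< a ℚ.+ ½ ℚ.* ε → ℚ.∣ ℚ.∣ a ∣ ℚ.- a ∣ ℚ.< ε
    close {ε} a 0<ε p with ℚ.∣p∣≡p∨∣p∣≡-p a
    ... | inj₁ eq = subst (ℚ._< ε) (≡.sym (≡.trans (cong (λ t → ℚ.∣ t ℚ.- a ∣) eq) (cong ℚ.∣_∣ (ℚ.+-inverseʳ a)))) 0<ε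
    ... | inj₂ eq = begin-strict
      ℚ.∣ ℚ.∣ a ∣ ℚ.- a ∣               ≡⟨ cong (λ t → ℚ.∣ t ℚ.- a ∣) eq ⟩
      ℚ.∣ ℚ.- a ℚ.- a ∣                 ≤⟨ ℚ.∣p+q∣≤∣p∣+∣q∣ (ℚ.- a) (ℚ.- a) ⟩
      ℚ.∣ ℚ.- a ∣ ℚ.+ ℚ.∣ ℚ.- a ∣       ≡⟨ cong (λ t → t ℚ.+ t) (≡.trans (ℚ.∣-p∣≡∣p∣ a) eq) ⟩
      ℚ.- a ℚ.+ ℚ.- a                   <⟨ ℚ.+-mono-< -a<½ε -a<½ε ⟩
      ½ ℚ.* ε ℚ.+ ½ ℚ.* ε               ≡⟨ half+half ε ⟩
      ε                                 ∎
      where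
      open ℚ.≤-Reasoning
      -a<½ε : ℚ.- a ℚ.< ½ ℚ.* ε
      -a<½ε = subst (ℚ._< ½ ℚ.* ε) (ℚ.+-identityˡ (ℚ.- a)) (a-b<ε {0ℚ} {a} p)

x≤∣x∣ : ∀ x → x ≤ʳ ∣ x ∣ℝ
x≤∣x∣ x = ≤-pointwise λ n → p≤∣p∣ (seq x n)

abstract
  -- Passing to `∣ x ∣ · ∣ y ∣` replaces sequences that may have negative terms by termwise
  -- nonnegative ones.
  0≤x*y : ∀ {x y} → 0ℝ ≤ʳ x → 0ℝ ≤ʳ y → 0ℝ ≤ʳ x *ℝ y
  0≤x*y {x} {y} 0≤x 0≤y = begin
    0ℝ                  ≤⟨ 0≤∣x∣ (x *ℝ y) ⟩
    ∣ x *ℝ y ∣ℝ         ≈⟨ ∣x*y∣≈∣x∣*∣y∣ x y ⟩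
    ∣ x ∣ℝ *ℝ ∣ y ∣ℝ    ≈⟨ *-cong (0≤x⇒∣x∣≈x 0≤x) (0≤x⇒∣x∣≈x 0≤y) ⟩
    x *ℝ y              ∎
    where open ≤-Reasoning

  *-monoʳ-≤ : ∀ {x y} z → 0ℝ ≤ʳ z → x ≤ʳ y → z *ℝ x ≤ʳ z *ℝ y
  *-monoʳ-≤ {x} {y} z 0≤z h = 0≤y-x⇒x≤y (begin
    0ℝ                   ≤⟨ 0≤x*y 0≤z (x≤y⇒0≤y-x h) ⟩
    z *ℝ (y -ℝ x)        ≈⟨ solve 3 (λ x y z → z :* (y :- x) := z :* y :- z :* x) ≈-refl x y z ⟩
    z *ℝ y -ℝ z *ℝ x     ∎)
    where open ≤-Reasoning

  *-monoˡ-≤ : ∀ {x y} z → 0ℝ ≤ʳ z → x ≤ʳ y → x *ℝ z ≤ʳ y *ℝ z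
  *-monoˡ-≤ {x} {y} z 0≤z h = begin
    x *ℝ z   ≈⟨ *-comm x z ⟩
    z *ℝ x   ≤⟨ *-monoʳ-≤ z 0≤z h ⟩
    z *ℝ y   ≈⟨ *-comm z y ⟩
    y *ℝ z   ∎
    where open ≤-Reasoning

  ≤-byε : ∀ {x y} → (∀ ε → 0ℚ ℚ.< ε → x ≤ʳ y +ℝ fromℚ ε) → x ≤ʳ y
  ≤-byε {x} {y} h = mk≤ λ ε 0<ε →
    let M , p = un≤ (h (½ ℚ.* ε) (0<half 0<ε)) (½ ℚ.* ε) (0<half 0<ε)
    in M , λ n hn → begin-strict
      seq x n                                 <⟨ p n hn ⟩
      (seq y n ℚ.+ ½ ℚ.* ε) ℚ.+ ½ ℚ.* ε       ≡⟨ ℚ.+-assoc (seq y n) _ _ ⟩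
      seq y n ℚ.+ (½ ℚ.* ε ℚ.+ ½ ℚ.* ε)       ≡⟨ cong (seq y n ℚ.+_) (half+half ε) ⟩
      seq y n ℚ.+ ε                           ∎
    where open ℚ.≤-Reasoning

  approx : ∀ x ε → 0ℚ ℚ.< ε → ∃[ a ] (x ≤ʳ fromℚ (a ℚ.+ ε) × fromℚ a ≤ʳ x +ℝ fromℚ ε)
  approx x ε 0<ε = let M , p = cauchy x ε 0<ε in
    seq x M
    , mk≤ (λ δ 0<δ → M , λ n hn → ℚ.<-trans (a<b+ε {seq x n} {seq x M} (p n M hn ℕ.≤-refl)) (q<q+δ 0<δ))
    , mk≤ (λ δ 0<δ → M , λ n hn → ℚ.<-trans (a<b+ε {seq x M} {seq x n} (p M n ℕ.≤-refl hn)) (q<q+δ 0<δ))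
    where
    q<q+δ : ∀ {q δ} → 0ℚ ℚ.< δ → q ℚ.< q ℚ.+ δ
    q<q+δ {q} {δ} 0<δ = subst (ℚ._< q ℚ.+ δ) (ℚ.+-identityʳ q) (ℚ.+-monoʳ-< q 0<δ)

  <-≤-trans : ∀ {x y z} → x <ℝ y → y ≤ʳ z → x <ℝ z
  <-≤-trans {x} {y} {z} (ε , 0<ε , h) (mk≤ g) = ½ ℚ.* ε , 0<half 0<ε , eventually₂
    (λ n p q → +-cancelʳ-< (½ ℚ.* ε) (seq x n ℚ.+ ½ ℚ.* ε) (seq z n) (begin-strict
      seq x n ℚ.+ ½ ℚ.* ε ℚ.+ ½ ℚ.* ε         ≡⟨ ℚ.+-assoc (seq x n) _ _ ⟩
      seq x n ℚ.+ (½ ℚ.* ε ℚ.+ ½ ℚ.* ε)       ≡⟨ cong (seq x n ℚ.+_) (half+half ε) ⟩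
      seq x n ℚ.+ ε                           <⟨ p ⟩
      seq y n                                 <⟨ q ⟩
      seq z n ℚ.+ ½ ℚ.* ε                     ∎))
    h (g (½ ℚ.* ε) (0<half 0<ε))
    where open ℚ.≤-Reasoning

  <-irrefl : ∀ {x} → ¬ (x <ℝ x)
  <-irrefl {x} (ε , 0<ε , M , h) = ℚ.<-asym 0<ε (+-cancelʳ-< (seq x M) ε 0ℚ
    (subst₂ ℚ._<_ (ℚ.+-comm (seq x M) ε) (≡.sym (ℚ.+-identityˡ (seq x M))) (h M ℕ.≤-refl)))

  fromℚ-mono-< : ∀ {p q} → p ℚ.< q → fromℚ p <ℝ fromℚ q
  fromℚ-mono-< {p} {q} h with ℚ.<-dense h
  ... | m , p<m , m<q = m ℚ.- p , 0<m-p , always λ _ → subst (ℚ._< q) (≡.sym (≡.trans (ℚ.+-comm p _) (sub-add m p))) m<q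
    where
    0<m-p : 0ℚ ℚ.< m ℚ.- p
    0<m-p = subst (ℚ._< m ℚ.- p) (ℚ.+-inverseʳ p) (ℚ.+-monoˡ-< (ℚ.- p) p<m)

  0<x⇒∃ε≤x : ∀ {x} → 0ℝ <ℝ x → ∃[ ε ] (0ℚ ℚ.< ε × fromℚ ε ≤ʳ x)
  0<x⇒∃ε≤x {x} (ε , 0<ε , M , h) = ε , 0<ε , ≤-eventually (M , λ n hn →
    ℚ.<⇒≤ (subst (ℚ._< seq x n) (ℚ.+-identityˡ ε) (h n hn)))

  ε≤x⇒0<x : ∀ {x ε} → 0ℚ ℚ.< ε → fromℚ ε ≤ʳ x → 0ℝ <ℝ x
  ε≤x⇒0<x 0<ε h = <-≤-trans {0ℝ} (fromℚ-mono-< 0<ε) h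


-- Reciprocals and approximate comparison.

module Reciprocal (ε : ℚ) (0<ε : 0ℚ ℚ.< ε) where

  ⊔ε-pos : ∀ p → ℚ.Positive (p ℚ.⊔ ε)
  ⊔ε-pos p = ℚ.positive (ℚ.<-≤-trans 0<ε (ℚ.p≤q⊔p p ε))

  -- Truncating at `ε` makes the reciprocal total. A real that is eventually at least `ε` does not
  -- notice the truncation in the limit.
  recip : ℚ → ℚ
  recip p = ℚ.1/_ (p ℚ.⊔ ε) {{ℚ.pos⇒nonZero (p ℚ.⊔ ε) {{⊔ε-pos p}}}}

  abstract
    recip-inverse : ∀ {p} → ε ℚ.≤ p → recip p ℚ.* p ≡ 1ℚ
    recip-inverse {p} h = subst (λ t → recip p ℚ.* t ≡ 1ℚ) (ℚ.p≥q⇒p⊔q≡p h)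
      (ℚ.*-inverseˡ (p ℚ.⊔ ε) {{ℚ.pos⇒nonZero (p ℚ.⊔ ε) {{⊔ε-pos p}}}})

    recip-pos : ∀ p → ℚ.Positive (recip p)
    recip-pos p = ℚ.1/pos⇒pos (p ℚ.⊔ ε) {{⊔ε-pos p}}

    0≤recip : ∀ p → 0ℚ ℚ.≤ recip p
    0≤recip p = ℚ.<⇒≤ (ℚ.positive⁻¹ (recip p) {{recip-pos p}})

    ∣recip∣-bounded : ∀ {p} → ε ℚ.≤ p → ℚ.∣ recip p ∣ ℚ.≤ recip ε
    ∣recip∣-bounded {p} h = subst (ℚ._≤ recip ε) (≡.sym (ℚ.0≤p⇒∣p∣≡p (0≤recip p)))
      (ℚ.*-cancelʳ-≤-pos ε {{ℚ.positive 0<ε}} (begin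
        recip p ℚ.* ε   ≤⟨ ℚ.*-monoˡ-≤-nonNeg (recip p) {{ℚ.nonNegative (0≤recip p)}} h ⟩
        recip p ℚ.* p   ≡⟨ recip-inverse h ⟩
        1ℚ              ≡⟨ recip-inverse ℚ.≤-refl ⟨
        recip ε ℚ.* ε   ∎))
      where open ℚ.≤-Reasoning

    recip-sub : ∀ {p q} → ε ℚ.≤ p → ε ℚ.≤ q → recip p ℚ.- recip q ≡ recip p ℚ.* (recip q ℚ.* (q ℚ.- p))
    recip-sub {p} {q} hp hq = ≡.sym (begin
      recip p ℚ.* (recip q ℚ.* (q ℚ.- p))
        ≡⟨ Q.solve 4 (λ a b p q → a Q.:* (b Q.:* (q Q.:- p)) Q.:= a Q.:* (b Q.:* q) Q.:- b Q.:* (a Q.:* p)) ≡.refl (recip p) (recip q) p q ⟩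
      recip p ℚ.* (recip q ℚ.* q) ℚ.- recip q ℚ.* (recip p ℚ.* p)
        ≡⟨ cong₂ (λ s t → recip p ℚ.* s ℚ.- recip q ℚ.* t) (recip-inverse hq) (recip-inverse hp) ⟩
      recip p ℚ.* 1ℚ ℚ.- recip q ℚ.* 1ℚ
        ≡⟨ cong₂ ℚ._-_ (ℚ.*-identityʳ (recip p)) (ℚ.*-identityʳ (recip q)) ⟩
      recip p ℚ.- recip q ∎)
      where open ≡.≡-Reasoning

    -- On `[ε, ∞)` the reciprocal is Lipschitz with constant `K²` for `K = 1/ε`, whence the two
    -- divisions by `K`.
    recip-cauchy : ∀ x → Cauchy x → Eventually (λ n → ε ℚ.≤ x n) → Cauchy (λ n → recip (x n))
    recip-cauchy x cx (M , h) δ 0<δ =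
      let K = recip ε
          K-pos = recip-pos ε
          η , 0<η , eq = divide K K-pos δ 0<δ
          θ , 0<θ , eq′ = divide K K-pos η 0<η
          L , close = cx θ 0<θ
      in M ℕ.⊔ L , λ m n hm hn →
        let xm = h m (ℕ.m⊔n≤o⇒m≤o M L hm)
            xn = h n (ℕ.m⊔n≤o⇒m≤o M L hn)
            open ℚ.≤-Reasoning
        in begin-strict
          ℚ.∣ recip (x m) ℚ.- recip (x n) ∣                             ≡⟨ cong ℚ.∣_∣ (recip-sub xm xn) ⟩
          ℚ.∣ recip (x m) ℚ.* (recip (x n) ℚ.* (x n ℚ.- x m)) ∣         ≤⟨ ∣a*b∣≤K*∣b∣ (recip (x m)) _ (∣recip∣-bounded xm) ⟩
          K ℚ.* ℚ.∣ recip (x n) ℚ.* (x n ℚ.- x m) ∣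
            ≤⟨ ℚ.*-monoˡ-≤-nonNeg K {{ℚ.pos⇒nonNeg K {{K-pos}}}} (∣a*b∣≤K*∣b∣ (recip (x n)) (x n ℚ.- x m) (∣recip∣-bounded xn)) ⟩
          K ℚ.* (K ℚ.* ℚ.∣ x n ℚ.- x m ∣)
            <⟨ ℚ.*-monoʳ-<-pos K {{K-pos}} (ℚ.*-monoʳ-<-pos K {{K-pos}} (close n m (ℕ.m⊔n≤o⇒n≤o M L hn) (ℕ.m⊔n≤o⇒n≤o M L hm))) ⟩
          K ℚ.* (K ℚ.* θ)                                               ≡⟨ ≡.trans (cong (K ℚ.*_) eq′) eq ⟩
          δ                                                             ∎

abstract
  invertible : ∀ {x} → 0ℝ <ℝ x → ∃[ y ] (0ℝ ≤ʳ y × y *ℝ x ≈ 1ℝ)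
  invertible {x} (ε , 0<ε , M , h) =
    mkℝ (λ n → recip (seq x n)) (recip-cauchy (seq x) (cauchy x) (M , ε≤x))
    , ≤-pointwise (λ n → 0≤recip (seq x n))
    , ≤-antisym (≤-eventually (M , λ n hn → ℚ.≤-reflexive (recip-inverse (ε≤x n hn))))
                (≤-eventually (M , λ n hn → ℚ.≤-reflexive (≡.sym (recip-inverse (ε≤x n hn)))))
    where
    open Reciprocal ε 0<ε
    ε≤x : ∀ n → M ℕ.≤ n → ε ℚ.≤ seq x n
    ε≤x n hn = ℚ.<⇒≤ (subst (ℚ._< seq x n) (ℚ.+-identityˡ ε) (h n hn))

  *-cancelʳ-≤ : ∀ {x y z} → 0ℝ <ℝ z → x *ℝ z ≤ʳ y *ℝ z → x ≤ʳ y
  *-cancelʳ-≤ {x} {y} {z} 0<z h with w , 0≤w , wz≈1 ← invertible 0<z = begin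
    x                 ≈⟨ undo x ⟩
    w *ℝ (x *ℝ z)     ≤⟨ *-monoʳ-≤ w 0≤w h ⟩
    w *ℝ (y *ℝ z)     ≈⟨ undo y ⟨
    y                 ∎
    where
    open ≤-Reasoning
    undo : ∀ t → t ≈ w *ℝ (t *ℝ z)
    undo t = begin-equality
      t                 ≈⟨ *-identityʳ t ⟨
      t *ℝ 1ℝ           ≈⟨ *-congˡ wz≈1 ⟨
      t *ℝ (w *ℝ z)     ≈⟨ solve 3 (λ t w z → t :* (w :* z) := w :* (t :* z)) ≈-refl t w z ⟩
      w *ℝ (t *ℝ z)     ∎

-- A constructive substitute for deciding `x ≤ ε`: the alternatives overlap on `[½ ε, ε]`, so a
-- rational `a` within `δ = ¼ ε` of `x` can choose. If `a + δ ≥ ε`, then `x ≥ a − δ ≥ ε − 2δ = ½ ε`.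
≤-or-≥ : ∀ x ε → 0ℚ ℚ.< ε → x ≤ʳ fromℚ ε ⊎ fromℚ (½ ℚ.* ε) ≤ʳ x
≤-or-≥ x ε 0<ε with a , x≤a+δ , a≤x+δ ← approx x (½ ℚ.* (½ ℚ.* ε)) (0<half (0<half 0<ε))
  with ℚ.≤-total (a ℚ.+ ½ ℚ.* (½ ℚ.* ε)) ε
... | inj₁ h = inj₁ (≤-trans x≤a+δ (fromℚ-mono-≤ h))
... | inj₂ h = inj₂ (begin
  fromℚ (½ ℚ.* ε)                               ≈⟨ ≈-pointwise (λ _ → Q.solve 1 (λ ε → Q.con ½ Q.:* ε Q.:= ε Q.:- δ′ ε Q.:- δ′ ε) ≡.refl ε) ⟩
  fromℚ ε -ℝ fromℚ δ -ℝ fromℚ δ                 ≤⟨ +-monoˡ-≤ (-ℝ fromℚ δ) (+-monoˡ-≤ (-ℝ fromℚ δ) (fromℚ-mono-≤ h)) ⟩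
  fromℚ (a ℚ.+ δ) -ℝ fromℚ δ -ℝ fromℚ δ         ≈⟨ ≈-pointwise (λ _ → Q.solve 2 (λ a δ → (a Q.:+ δ) Q.:- δ Q.:- δ Q.:= a Q.:- δ) ≡.refl a δ) ⟩
  fromℚ a -ℝ fromℚ δ                            ≤⟨ +-monoˡ-≤ (-ℝ fromℚ δ) a≤x+δ ⟩
  x +ℝ fromℚ δ -ℝ fromℚ δ                       ≈⟨ solve 2 (λ x d → x :+ d :- d := x) ≈-refl x (fromℚ δ) ⟩
  x                                             ∎)
  where
  open ≤-Reasoning
  δ = ½ ℚ.* (½ ℚ.* ε)
  δ′ : ∀ {n} → Q.Polynomial n → Q.Polynomial n
  δ′ e = Q.con ½ Q.:* (Q.con ½ Q.:* e)

upperBound : ∀ x → ∃[ K ] (0ℚ ℚ.< K × x ≤ʳ fromℚ K)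
upperBound x with a , x≤a+1 , _ ← approx x 1ℚ (ℚ.positive⁻¹ 1ℚ) =
  (a ℚ.+ 1ℚ) ℚ.⊔ 1ℚ , ℚ.<-≤-trans (ℚ.positive⁻¹ 1ℚ) (ℚ.p≤q⊔p (a ℚ.+ 1ℚ) 1ℚ)
  , ≤-trans x≤a+1 (fromℚ-mono-≤ (ℚ.p≤p⊔q (a ℚ.+ 1ℚ) 1ℚ))

-- Finite sums, the L₁ norm and the simplex.

sum-mono-≤ : ∀ {n} {f g : Vector ℝ n} → (∀ i → f i ≤ʳ g i) → sumℝ f ≤ʳ sumℝ g
sum-mono-≤ {zero}  h = ≤-refl
sum-mono-≤ {suc n} h = +-mono-≤ (h zero) (sum-mono-≤ λ i → h (suc i))

0≤sum : ∀ {n} {f : Vector ℝ n} → (∀ i → 0ℝ ≤ʳ f i) → 0ℝ ≤ʳ sumℝ f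
0≤sum {n} h = ≤-trans (≈⇒≤ (≈-sym (sum-replicate-zero n))) (sum-mono-≤ h)

term≤sum : ∀ {n} {f : Vector ℝ n} → (∀ i → 0ℝ ≤ʳ f i) → ∀ i → f i ≤ʳ sumℝ f
term≤sum {suc n} {f} h zero = begin
  f zero                               ≈⟨ +-identityʳ (f zero) ⟨
  f zero +ℝ 0ℝ                         ≤⟨ +-monoʳ-≤ (f zero) (0≤sum λ i → h (suc i)) ⟩
  f zero +ℝ sumℝ (λ i → f (suc i))     ∎
  where open ≤-Reasoning
term≤sum {suc n} {f} h (suc i) = begin
  f (suc i)                            ≈⟨ +-identityˡ (f (suc i)) ⟨
  0ℝ +ℝ f (suc i)                      ≤⟨ +-mono-≤ (h zero) (term≤sum (λ j → h (suc j)) i) ⟩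
  f zero +ℝ sumℝ (λ i → f (suc i))     ∎
  where open ≤-Reasoning

sum-sub : ∀ {n} (f g : Vector ℝ n) → sumℝ (λ i → f i -ℝ g i) ≈ sumℝ f -ℝ sumℝ g
sum-sub {zero}  f g = solve 0 (con 0ℚ := con 0ℚ :- con 0ℚ) ≈-refl
sum-sub {suc n} f g = ≈-trans (+-congˡ (sum-sub (λ i → f (suc i)) (λ i → g (suc i))))
  (solve 4 (λ a b s t → a :- b :+ (s :- t) := a :+ s :- (b :+ t)) ≈-refl (f zero) (g zero) _ _)

-- Each term takes half of the remaining budget, which avoids dividing by `n`. The threshold serves
-- for the coordinate errors of a grid point and for the costs of cheap edges.
sum-small : ∀ n ε → 0ℚ ℚ.< ε →
  ∃[ η ] (0ℚ ℚ.< η × (∀ (f : Vector ℝ n) → (∀ i → f i ≤ʳ fromℚ η) → sumℝ f ≤ʳ fromℚ ε))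
sum-small zero    ε 0<ε = ε , 0<ε , λ _ _ → fromℚ-mono-≤ (ℚ.<⇒≤ 0<ε)
sum-small (suc n) ε 0<ε with η , 0<η , small ← sum-small n (½ ℚ.* ε) (0<half 0<ε) =
  η ℚ.⊓ (½ ℚ.* ε) , 0<⊓ (ℚ.⊓-sel η (½ ℚ.* ε)) , λ f h → begin
    f zero +ℝ sumℝ (λ i → f (suc i))
      ≤⟨ +-mono-≤ (≤-trans (h zero) (fromℚ-mono-≤ (ℚ.p⊓q≤q η _)))
                  (small _ λ i → ≤-trans (h (suc i)) (fromℚ-mono-≤ (ℚ.p⊓q≤p η _))) ⟩
    fromℚ (½ ℚ.* ε) +ℝ fromℚ (½ ℚ.* ε)   ≈⟨ ≈-pointwise (λ _ → half+half ε) ⟩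
    fromℚ ε                              ∎
  where
  open ≤-Reasoning
  0<⊓ : η ℚ.⊓ (½ ℚ.* ε) ≡ η ⊎ η ℚ.⊓ (½ ℚ.* ε) ≡ ½ ℚ.* ε → 0ℚ ℚ.< η ℚ.⊓ (½ ℚ.* ε)
  0<⊓ (inj₁ eq) = subst (0ℚ ℚ.<_) (≡.sym eq) 0<η
  0<⊓ (inj₂ eq) = subst (0ℚ ℚ.<_) (≡.sym eq) (0<half 0<ε)

L₁ : ∀ {k} → Vector ℝ k → ℝ
L₁ x = sumℝ (λ i → ∣ x i ∣ℝ)

0≤L₁ : ∀ {k} (x : Vector ℝ k) → 0ℝ ≤ʳ L₁ x
0≤L₁ x = 0≤sum λ i → 0≤∣x∣ (x i)

L₁-triangle : ∀ {k} (x y z : Vector ℝ k) → L₁ (x -ᵛ z) ≤ʳ L₁ (x -ᵛ y) +ℝ L₁ (y -ᵛ z)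
L₁-triangle x y z = begin
  sumℝ (λ i → ∣ x i -ℝ z i ∣ℝ)
    ≤⟨ sum-mono-≤ (λ i → ≤-trans
         (≈⇒≤ (∣∣-cong (solve 3 (λ x y z → x :- z := (x :- y) :+ (y :- z)) ≈-refl (x i) (y i) (z i))))
         (∣x+y∣≤∣x∣+∣y∣ (x i -ℝ y i) (y i -ℝ z i))) ⟩
  sumℝ (λ i → ∣ x i -ℝ y i ∣ℝ +ℝ ∣ y i -ℝ z i ∣ℝ)
    ≈⟨ ∑-distrib-+ (λ i → ∣ x i -ℝ y i ∣ℝ) (λ i → ∣ y i -ℝ z i ∣ℝ) ⟩
  L₁ (x -ᵛ y) +ℝ L₁ (y -ᵛ z) ∎
  where open ≤-Reasoning

∣x-y∣≈∣y-x∣ : ∀ x y → ∣ x -ℝ y ∣ℝ ≈ ∣ y -ℝ x ∣ℝ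
∣x-y∣≈∣y-x∣ x y = ≈-pointwise λ n → ∣a-b∣≡∣b-a∣ (seq x n) (seq y n)

L₁-sym : ∀ {k} (x y : Vector ℝ k) → L₁ (x -ᵛ y) ≈ L₁ (y -ᵛ x)
L₁-sym x y = sum-cong-≋ λ i → ∣x-y∣≈∣y-x∣ (x i) (y i)

∣sum∣≤L₁ : ∀ {n} (f : Vector ℝ n) → ∣ sumℝ f ∣ℝ ≤ʳ L₁ f
∣sum∣≤L₁ {zero}  f = ≈⇒≤ (0≤x⇒∣x∣≈x ≤-refl)
∣sum∣≤L₁ {suc n} f = ≤-trans (∣x+y∣≤∣x∣+∣y∣ (f zero) _) (+-monoʳ-≤ ∣ f zero ∣ℝ (∣sum∣≤L₁ λ i → f (suc i)))

sum-*-vertex : ∀ {k} (a : Vector ℝ k) l → sumℝ (λ i → a i *ℝ vertex i l) ≈ a l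
sum-*-vertex {suc k} a zero = begin-equality
  a zero *ℝ 1ℝ +ℝ sumℝ (λ i → a (suc i) *ℝ 0ℝ)
    ≈⟨ +-cong (*-identityʳ (a zero)) (≈-trans (sum-cong-≋ λ i → zeroʳ (a (suc i))) (sum-replicate-zero k)) ⟩
  a zero +ℝ 0ℝ     ≈⟨ +-identityʳ (a zero) ⟩
  a zero           ∎
  where open ≤-Reasoning
sum-*-vertex {suc k} a (suc l) =
  ≈-trans (+-cong (zeroʳ (a zero)) (sum-*-vertex (λ i → a (suc i)) l)) (+-identityˡ (a (suc l)))

vertex∈simplex : ∀ {k} (i : Fin k) → InSimplex (vertex i)
vertex∈simplex i = (λ j → un≤ (nonNeg i j)) , un≈ (total i)
  where
  nonNeg : ∀ {k} (i j : Fin k) → 0ℝ ≤ʳ vertex i j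
  nonNeg zero    zero    = fromℚ-mono-≤ (ℚ.nonNegative⁻¹ 1ℚ)
  nonNeg zero    (suc j) = ≤-refl
  nonNeg (suc i) zero    = ≤-refl
  nonNeg (suc i) (suc j) = nonNeg i j
  total : ∀ {k} (i : Fin k) → sumℝ (vertex i) ≈ 1ℝ
  total {suc k} zero    = ≈-trans (+-congˡ (sum-replicate-zero k)) (+-identityʳ 1ℝ)
  total {suc k} (suc i) = ≈-trans (+-identityˡ _) (total i)

simplex-sum-sub : ∀ {k} (x y : Vector ℝ k) → InSimplex x → InSimplex y → sumℝ (x -ᵛ y) ≈ 0ℝ
simplex-sum-sub x y (_ , Σx) (_ , Σy) = begin-equality
  sumℝ (x -ᵛ y)       ≈⟨ sum-sub x y ⟩
  sumℝ x -ℝ sumℝ y    ≈⟨ +-cong (mk≈ Σx) (neg-cong (mk≈ Σy)) ⟩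
  1ℝ -ℝ 1ℝ            ≈⟨ solve 0 (con 1ℚ :- con 1ℚ := con 0ℚ) ≈-refl ⟩
  0ℝ                  ∎
  where open ≤-Reasoning

½L₁≤1 : ∀ {k} (x y : Vector ℝ k) → InSimplex x → InSimplex y → ½L₁ (x -ᵛ y) ≤ʳ 1ℝ
½L₁≤1 x y x∈Δ y∈Δ = begin
  fromℚ ½ *ℝ L₁ (x -ᵛ y)       ≤⟨ *-monoʳ-≤ (fromℚ ½) 0≤½ (sum-mono-≤ λ i →
    ≤-trans (∣x+y∣≤∣x∣+∣y∣ (x i) (-ℝ y i)) (≈⇒≤ (+-congˡ (∣-x∣≈∣x∣ (y i))))) ⟩
  fromℚ ½ *ℝ sumℝ (λ i → ∣ x i ∣ℝ +ℝ ∣ y i ∣ℝ)   ≈⟨ *-congˡ (∑-distrib-+ (λ i → ∣ x i ∣ℝ) (λ i → ∣ y i ∣ℝ)) ⟩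
  fromℚ ½ *ℝ (L₁ x +ℝ L₁ y)    ≈⟨ *-congˡ (+-cong (norm x x∈Δ) (norm y y∈Δ)) ⟩
  fromℚ ½ *ℝ (1ℝ +ℝ 1ℝ)        ≈⟨ solve 0 (con ½ :* (con 1ℚ :+ con 1ℚ) := con 1ℚ) ≈-refl ⟩
  1ℝ                           ∎
  where
  open ≤-Reasoning
  0≤½ : 0ℝ ≤ʳ fromℚ ½
  0≤½ = fromℚ-mono-≤ (ℚ.nonNegative⁻¹ ½)
  norm : ∀ z → InSimplex z → L₁ z ≈ 1ℝ
  norm z (0≤z , Σz) = ≈-trans (sum-cong-≋ λ i → 0≤x⇒∣x∣≈x (mk≤ (0≤z i))) (mk≈ Σz)

-- The scalar t cannot be cancelled when it may vanish; the linear bound covers small t.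
≤-from-squares : ∀ {n t K} → 0ℚ ℚ.< K → n ≤ʳ fromℚ K *ℝ t → 0ℝ ≤ʳ t → n *ℝ t ≤ʳ t *ℝ t → n ≤ʳ t
≤-from-squares {n} {t} {K} 0<K n≤Kt 0≤t nt≤tt = ≤-byε λ ε 0<ε → bound ε (divide K (ℚ.positive 0<K) ε 0<ε)
  where
  open ≤-Reasoning
  bound : ∀ ε → ∃[ δ ] (0ℚ ℚ.< δ × K ℚ.* δ ≡ ε) → n ≤ʳ t +ℝ fromℚ ε
  bound ε (δ , 0<δ , Kδ≡ε) with ≤-or-≥ t δ 0<δ
  ... | inj₁ t≤δ = begin
    n                        ≤⟨ n≤Kt ⟩
    fromℚ K *ℝ t             ≤⟨ *-monoʳ-≤ (fromℚ K) (fromℚ-mono-≤ (ℚ.<⇒≤ 0<K)) t≤δ ⟩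
    fromℚ K *ℝ fromℚ δ       ≈⟨ ≈-pointwise (λ _ → Kδ≡ε) ⟩
    fromℚ ε                  ≈⟨ +-identityˡ (fromℚ ε) ⟨
    0ℝ +ℝ fromℚ ε            ≤⟨ +-monoˡ-≤ (fromℚ ε) 0≤t ⟩
    t +ℝ fromℚ ε             ∎
  ... | inj₂ δ/2≤t = begin
    n                        ≤⟨ *-cancelʳ-≤ (ε≤x⇒0<x (0<half 0<δ) δ/2≤t) nt≤tt ⟩
    t                        ≈⟨ +-identityʳ t ⟨
    t +ℝ 0ℝ                  ≤⟨ +-monoʳ-≤ t (fromℚ-mono-≤ 0≤ε) ⟩
    t +ℝ fromℚ ε             ∎
    where
    0≤ε : 0ℚ ℚ.≤ ε
    0≤ε = subst₂ ℚ._≤_ (ℚ.*-zeroʳ K) Kδ≡ε (ℚ.*-monoˡ-≤-nonNeg K {{ℚ.nonNegative (ℚ.<⇒≤ 0<K)}} (ℚ.<⇒≤ 0<δ))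

-- Norms compared with L₁, in general and on differences of simplex points.

module Norm {k : ℕ} {N : Vector ℝ k → ℝ} (isNorm : IsNorm N) where
  open IsNorm isNorm

  N-cong : ∀ {x y} → (∀ i → x i ≈ y i) → N x ≈ N y
  N-cong {x} {y} h = mk≈ (respects x y λ i → un≈ (h i))

  0≤N : ∀ x → 0ℝ ≤ʳ N x
  0≤N x = mk≤ (N≥0 x)

  N-· : ∀ a x → N (a ·ᵛ x) ≈ ∣ a ∣ℝ *ℝ N x
  N-· a x = mk≈ (homogeneous a x)

  N-0 : N (λ _ → 0ℝ) ≈ 0ℝ
  N-0 = begin-equality
    N (λ _ → 0ℝ)                ≈⟨ N-cong (λ _ → zeroʳ 0ℝ) ⟨
    N (0ℝ ·ᵛ (λ _ → 0ℝ))        ≈⟨ N-· 0ℝ (λ _ → 0ℝ) ⟩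
    ∣ 0ℝ ∣ℝ *ℝ N (λ _ → 0ℝ)     ≈⟨ *-congʳ (0≤x⇒∣x∣≈x ≤-refl) ⟩
    0ℝ *ℝ N (λ _ → 0ℝ)          ≈⟨ zeroˡ _ ⟩
    0ℝ                          ∎
    where open ≤-Reasoning

  N-sym : ∀ x y → N (x -ᵛ y) ≈ N (y -ᵛ x)
  N-sym x y = begin-equality
    N (x -ᵛ y)                          ≈⟨ N-cong (λ i → solve 2 (λ x y → x :- y := con (ℚ.- 1ℚ) :* (y :- x)) ≈-refl (x i) (y i)) ⟩
    N (fromℚ (ℚ.- 1ℚ) ·ᵛ (y -ᵛ x))      ≈⟨ N-· (fromℚ (ℚ.- 1ℚ)) (y -ᵛ x) ⟩
    ∣ fromℚ (ℚ.- 1ℚ) ∣ℝ *ℝ N (y -ᵛ x)   ≈⟨ *-congʳ (≈-pointwise λ _ → ≡.refl) ⟩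
    1ℝ *ℝ N (y -ᵛ x)                    ≈⟨ *-identityˡ _ ⟩
    N (y -ᵛ x)                          ∎
    where open ≤-Reasoning

  N-triangle : ∀ x y z → N (x -ᵛ z) ≤ʳ N (x -ᵛ y) +ℝ N (y -ᵛ z)
  N-triangle x y z = ≤-trans
    (≈⇒≤ (N-cong λ i → solve 3 (λ x y z → x :- z := (x :- y) :+ (y :- z)) ≈-refl (x i) (y i) (z i)))
    (mk≤ (triangle (x -ᵛ y) (y -ᵛ z)))

  N-sum : ∀ {m} (a : Vector ℝ m) (v : Fin m → Vector ℝ k) →
    N (λ l → sumℝ (λ i → a i *ℝ v i l)) ≤ʳ sumℝ (λ i → ∣ a i ∣ℝ *ℝ N (v i))
  N-sum {zero}  a v = ≈⇒≤ N-0
  N-sum {suc m} a v = begin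
    N ((a zero ·ᵛ v zero) +ᵛ rest)                   ≤⟨ mk≤ (triangle (a zero ·ᵛ v zero) rest) ⟩
    N (a zero ·ᵛ v zero) +ℝ N rest                   ≤⟨ +-mono-≤ (≈⇒≤ (N-· (a zero) (v zero))) (N-sum (λ i → a (suc i)) (λ i → v (suc i))) ⟩
    sumℝ (λ i → ∣ a i ∣ℝ *ℝ N (v i))                 ∎
    where
    open ≤-Reasoning
    rest : Vector ℝ k
    rest l = sumℝ (λ i → a (suc i) *ℝ v (suc i) l)

  -- Bounding the sum of the nonnegative values `N (vertex i)` bounds each of them. The bound is a
  -- positive rational so that it can be divided by.
  bound : ∃[ K ] (0ℚ ℚ.< K × sumℝ (λ i → N (vertex i)) ≤ʳ fromℚ K)
  bound = upperBound (sumℝ (λ i → N (vertex i)))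

  K : ℚ
  K = proj₁ bound

  0<K : 0ℚ ℚ.< K
  0<K = proj₁ (proj₂ bound)

  0≤K : 0ℝ ≤ʳ fromℚ K
  0≤K = fromℚ-mono-≤ (ℚ.<⇒≤ 0<K)

  N≤K*L₁ : ∀ x → N x ≤ʳ fromℚ K *ℝ L₁ x
  N≤K*L₁ x = begin
    N x                                             ≈⟨ N-cong (sum-*-vertex x) ⟨
    N (λ l → sumℝ (λ i → x i *ℝ vertex i l))        ≤⟨ N-sum x vertex ⟩
    sumℝ (λ i → ∣ x i ∣ℝ *ℝ N (vertex i))           ≤⟨ sum-mono-≤ (λ i → *-monoʳ-≤ ∣ x i ∣ℝ (0≤∣x∣ (x i))
      (≤-trans (term≤sum (λ j → 0≤N (vertex j)) i) (proj₂ (proj₂ bound)))) ⟩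
    sumℝ (λ i → ∣ x i ∣ℝ *ℝ fromℚ K)                ≈⟨ *-distribʳ-sum (fromℚ K) (λ i → ∣ x i ∣ℝ) ⟨
    L₁ x *ℝ fromℚ K                                 ≈⟨ *-comm _ _ ⟩
    fromℚ K *ℝ L₁ x                                 ∎
    where open ≤-Reasoning

  N-lipschitz : ∀ x y → N x ≤ʳ N y +ℝ fromℚ K *ℝ L₁ (x -ᵛ y)
  N-lipschitz x y = begin
    N x                                 ≈⟨ N-cong (λ i → solve 2 (λ x y → x := y :+ (x :- y)) ≈-refl (x i) (y i)) ⟩
    N (y +ᵛ (x -ᵛ y))                   ≤⟨ mk≤ (triangle y (x -ᵛ y)) ⟩
    N y +ℝ N (x -ᵛ y)                   ≤⟨ +-monoʳ-≤ (N y) (N≤K*L₁ (x -ᵛ y)) ⟩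
    N y +ℝ fromℚ K *ℝ L₁ (x -ᵛ y)       ∎
    where open ≤-Reasoning

  -- Writing d = P − M with P, M ≥ 0 of equal total T, the identity
  -- T d = Σ Pᵢ Mⱼ (eᵢ − eⱼ) bounds T · N d by T².
  module _ (N-edge≤1 : ∀ i j → N (vertex i -ᵛ vertex j) ≤ʳ 1ℝ) (d : Vector ℝ k) (Σd≈0 : sumℝ d ≈ 0ℝ) where
    private
      P M : Vector ℝ k
      P i = fromℚ ½ *ℝ (∣ d i ∣ℝ +ℝ d i)
      M i = fromℚ ½ *ℝ (∣ d i ∣ℝ -ℝ d i)

      T : ℝ
      T = ½L₁ d

      0≤½ : 0ℝ ≤ʳ fromℚ ½
      0≤½ = fromℚ-mono-≤ (ℚ.nonNegative⁻¹ ½)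

      0≤T : 0ℝ ≤ʳ T
      0≤T = 0≤x*y 0≤½ (0≤L₁ d)

      0≤P : ∀ i → 0ℝ ≤ʳ P i
      0≤P i = 0≤x*y 0≤½ (begin
        0ℝ                             ≤⟨ x≤y⇒0≤y-x (x≤∣x∣ (-ℝ d i)) ⟩
        ∣ -ℝ d i ∣ℝ -ℝ -ℝ d i          ≈⟨ +-congʳ (∣-x∣≈∣x∣ (d i)) ⟩
        ∣ d i ∣ℝ -ℝ -ℝ d i             ≈⟨ solve 2 (λ a d → a :- (:- d) := a :+ d) ≈-refl ∣ d i ∣ℝ (d i) ⟩
        ∣ d i ∣ℝ +ℝ d i                ∎)
        where open ≤-Reasoning

      0≤M : ∀ i → 0ℝ ≤ʳ M i
      0≤M i = 0≤x*y 0≤½ (x≤y⇒0≤y-x (x≤∣x∣ (d i)))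

      ΣP≈T : sumℝ P ≈ T
      ΣP≈T = begin-equality
        sumℝ P                                          ≈⟨ *-distribˡ-sum (fromℚ ½) (λ i → ∣ d i ∣ℝ +ℝ d i) ⟨
        fromℚ ½ *ℝ sumℝ (λ i → ∣ d i ∣ℝ +ℝ d i)         ≈⟨ *-congˡ (∑-distrib-+ (λ i → ∣ d i ∣ℝ) d) ⟩
        fromℚ ½ *ℝ (L₁ d +ℝ sumℝ d)                     ≈⟨ *-congˡ (≈-trans (+-congˡ Σd≈0) (+-identityʳ (L₁ d))) ⟩
        T                                               ∎
        where open ≤-Reasoning

      ΣM≈T : sumℝ M ≈ T
      ΣM≈T = begin-equality
        sumℝ M                                          ≈⟨ *-distribˡ-sum (fromℚ ½) (λ i → ∣ d i ∣ℝ -ℝ d i) ⟨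
        fromℚ ½ *ℝ sumℝ (λ i → ∣ d i ∣ℝ -ℝ d i)         ≈⟨ *-congˡ (sum-sub (λ i → ∣ d i ∣ℝ) d) ⟩
        fromℚ ½ *ℝ (L₁ d -ℝ sumℝ d)                     ≈⟨ *-congˡ (+-congˡ (neg-cong Σd≈0)) ⟩
        fromℚ ½ *ℝ (L₁ d -ℝ 0ℝ)                         ≈⟨ solve 1 (λ s → con ½ :* (s :- con 0ℚ) := con ½ :* s) ≈-refl (L₁ d) ⟩
        T                                               ∎
        where open ≤-Reasoning

      -- The inner part of the double sum, equal to `T eᵢ − M`. Its norm is at most `T` because the
      -- weights `Mⱼ` add up to `T`.
      w : Fin k → Vector ℝ k
      w i l = sumℝ (λ j → M j *ℝ (vertex i -ᵛ vertex j) l)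

      N-w≤T : ∀ i → N (w i) ≤ʳ T
      N-w≤T i = begin
        N (w i)                                                     ≤⟨ N-sum M (λ j → vertex i -ᵛ vertex j) ⟩
        sumℝ (λ j → ∣ M j ∣ℝ *ℝ N (vertex i -ᵛ vertex j))           ≤⟨ sum-mono-≤ (λ j → *-monoʳ-≤ ∣ M j ∣ℝ (0≤∣x∣ (M j)) (N-edge≤1 i j)) ⟩
        sumℝ (λ j → ∣ M j ∣ℝ *ℝ 1ℝ)                                 ≈⟨ sum-cong-≋ (λ j → ≈-trans (*-identityʳ _) (0≤x⇒∣x∣≈x (0≤M j))) ⟩
        sumℝ M                                                      ≈⟨ ΣM≈T ⟩
        T                                                           ∎
        where open ≤-Reasoning

      w-coordinate : ∀ i l → w i l ≈ vertex i l *ℝ T -ℝ M l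
      w-coordinate i l = begin-equality
        sumℝ (λ j → M j *ℝ (vertex i l -ℝ vertex j l))
          ≈⟨ sum-cong-≋ (λ j → solve 3 (λ m a b → m :* (a :- b) := a :* m :- m :* b) ≈-refl (M j) (vertex i l) (vertex j l)) ⟩
        sumℝ (λ j → vertex i l *ℝ M j -ℝ M j *ℝ vertex j l)
          ≈⟨ sum-sub (λ j → vertex i l *ℝ M j) (λ j → M j *ℝ vertex j l) ⟩
        sumℝ (λ j → vertex i l *ℝ M j) -ℝ sumℝ (λ j → M j *ℝ vertex j l)
          ≈⟨ +-cong (≈-trans (≈-sym (*-distribˡ-sum (vertex i l) M)) (*-congˡ ΣM≈T)) (neg-cong (sum-*-vertex M l)) ⟩
        vertex i l *ℝ T -ℝ M l ∎
        where open ≤-Reasoning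

      decomposition : ∀ l → T *ℝ d l ≈ sumℝ (λ i → P i *ℝ w i l)
      decomposition l = begin-equality
        T *ℝ d l
          ≈⟨ solve 3 (λ t a d → t :* d := con ½ :* (a :+ d) :* t :- t :* (con ½ :* (a :- d))) ≈-refl T ∣ d l ∣ℝ (d l) ⟩
        P l *ℝ T -ℝ T *ℝ M l
          ≈⟨ +-cong (*-congʳ (sum-*-vertex P l)) (neg-cong (*-congʳ ΣP≈T)) ⟨
        sumℝ (λ i → P i *ℝ vertex i l) *ℝ T -ℝ sumℝ P *ℝ M l
          ≈⟨ +-cong (*-distribʳ-sum T (λ i → P i *ℝ vertex i l)) (neg-cong (*-distribʳ-sum (M l) P)) ⟩
        sumℝ (λ i → P i *ℝ vertex i l *ℝ T) -ℝ sumℝ (λ i → P i *ℝ M l)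
          ≈⟨ sum-sub (λ i → P i *ℝ vertex i l *ℝ T) (λ i → P i *ℝ M l) ⟨
        sumℝ (λ i → P i *ℝ vertex i l *ℝ T -ℝ P i *ℝ M l)
          ≈⟨ sum-cong-≋ (λ i → ≈-trans
               (solve 4 (λ p e t m → p :* e :* t :- p :* m := p :* (e :* t :- m)) ≈-refl (P i) (vertex i l) T (M l))
               (*-congˡ (≈-sym (w-coordinate i l)))) ⟩
        sumℝ (λ i → P i *ℝ w i l) ∎
        where open ≤-Reasoning

      N-d*T≤T*T : N d *ℝ T ≤ʳ T *ℝ T
      N-d*T≤T*T = begin
        N d *ℝ T                                   ≈⟨ *-comm (N d) T ⟩
        T *ℝ N d                                   ≈⟨ *-congʳ (0≤x⇒∣x∣≈x 0≤T) ⟨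
        ∣ T ∣ℝ *ℝ N d                              ≈⟨ N-· T d ⟨
        N (T ·ᵛ d)                                 ≈⟨ N-cong decomposition ⟩
        N (λ l → sumℝ (λ i → P i *ℝ w i l))        ≤⟨ N-sum P w ⟩
        sumℝ (λ i → ∣ P i ∣ℝ *ℝ N (w i))           ≤⟨ sum-mono-≤ (λ i → *-monoʳ-≤ ∣ P i ∣ℝ (0≤∣x∣ (P i)) (N-w≤T i)) ⟩
        sumℝ (λ i → ∣ P i ∣ℝ *ℝ T)                 ≈⟨ sum-cong-≋ (λ i → *-congʳ (0≤x⇒∣x∣≈x (0≤P i))) ⟩
        sumℝ (λ i → P i *ℝ T)                      ≈⟨ *-distribʳ-sum T P ⟨
        sumℝ P *ℝ T                                ≈⟨ *-congʳ ΣP≈T ⟩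
        T *ℝ T                                     ∎
        where open ≤-Reasoning

      -- The linear bound that covers small `T`; the factor 2 appears because `T` is half of the L₁
      -- norm.
      N-d≤2K*T : N d ≤ʳ fromℚ (K ℚ.+ K) *ℝ T
      N-d≤2K*T = begin
        N d                            ≤⟨ N≤K*L₁ d ⟩
        fromℚ K *ℝ L₁ d                ≈⟨ solve 2 (λ K s → K :* s := (K :+ K) :* (con ½ :* s)) ≈-refl (fromℚ K) (L₁ d) ⟩
        (fromℚ K +ℝ fromℚ K) *ℝ T      ≈⟨ *-congʳ (≈-pointwise λ _ → ≡.refl) ⟩
        fromℚ (K ℚ.+ K) *ℝ T           ∎
        where open ≤-Reasoning

    N≤½L₁ : N d ≤ʳ ½L₁ d
    N≤½L₁ = ≤-from-squares (ℚ.+-mono-< 0<K 0<K) N-d≤2K*T 0≤T N-d*T≤T*T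

-- Infima of real functions from finite nets.

fromℚ-cancel-≤ : ∀ {p q} → fromℚ p ≤ʳ fromℚ q → p ℚ.≤ q
fromℚ-cancel-≤ {p} {q} h with p ℚ.≤? q
... | yes p≤q = p≤q
... | no  p≰q = contradiction (<-≤-trans {fromℚ q} {fromℚ p} (fromℚ-mono-< (ℚ.≰⇒> p≰q)) h) (<-irrefl {fromℚ q})

abstract
  unit : ℕ → ℚ
  unit n = mkℚ (ℤ.+ 1) n (ℕ.1-coprimeTo (suc n))

  0<unit : ∀ n → 0ℚ ℚ.< unit n
  0<unit n = ℚ.positive⁻¹ (unit n)

  -- `mkℚ` stores the denominator less one, so `unit n` is `1/(n + 1)`, and for
  -- `ε = (a + 1)/(d + 1)` any `n ≥ d` will do.
  unit-small : ∀ ε → 0ℚ ℚ.< ε → Eventually (λ n → unit n ℚ.≤ ε)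
  unit-small (mkℚ (ℤ.+ zero)  d _) (ℚ.*<* (ℤ.+<+ ()))
  unit-small (mkℚ ℤ.+[1+ a ]  d _) _ = d , λ n d≤n → ℚ.*≤* (ℤ.+≤+ (ℕ.*-mono-≤ (ℕ.s≤s (ℕ.z≤n {a})) (ℕ.s≤s d≤n)))
  unit-small (mkℚ ℤ.-[1+ a ]  d _) (ℚ.*<* ())

fromℚ-half+half : ∀ x ε → x +ℝ fromℚ (½ ℚ.* ε) +ℝ fromℚ (½ ℚ.* ε) ≈ x +ℝ fromℚ ε
fromℚ-half+half x ε = ≈-trans (+-assoc x _ _) (+-congˡ (≈-pointwise λ _ → half+half ε))

-- Up to `u n`, the rational `q n` is a lower bound of `P`, and the member `p n` of `P` does not
-- exceed it. Hence `q m` and `q n` differ by at most `u m + u n`, and the sequence `q` is itself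
-- the infimum as a Cauchy real; no limit of reals has to be formed.
module Infimum (P : Pred ℝ 0ℓ) (u : ℕ → ℚ) (u-small : ∀ ε → 0ℚ ℚ.< ε → Eventually (λ n → u n ℚ.≤ ε))
  (q : ℕ → ℚ) (q-lower : ∀ n x → P x → fromℚ (q n) ≤ʳ x +ℝ fromℚ (u n))
  (p : ℕ → ℝ) (p∈P : ∀ n → P (p n)) (p≤q : ∀ n → p n ≤ʳ fromℚ (q n) +ℝ fromℚ (u n)) where

  q-near : ∀ m n → q m ℚ.≤ q n ℚ.+ u n ℚ.+ u m
  q-near m n = fromℚ-cancel-≤ (≤-trans (q-lower m (p n) (p∈P n))
    (≤-trans (+-monoˡ-≤ (fromℚ (u m)) (p≤q n)) (≤-pointwise λ _ → ℚ.≤-refl)))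

  abstract
    q-cauchy : Cauchy q
    q-cauchy ε 0<ε =
      let δ , 0<δ , δ<½ε = ℚ.<-dense (0<half 0<ε)
          M , small = u-small δ 0<δ
          near : ∀ m n → M ℕ.≤ m → M ℕ.≤ n → q m ℚ.< q n ℚ.+ ε
          near m n hm hn = ℚ.≤-<-trans (q-near m n) (subst (ℚ._< q n ℚ.+ ε) (≡.sym (ℚ.+-assoc (q n) (u n) (u m)))
            (ℚ.+-monoʳ-< (q n) (subst (u n ℚ.+ u m ℚ.<_) (half+half ε)
              (ℚ.+-mono-< (ℚ.≤-<-trans (small n hn) δ<½ε) (ℚ.≤-<-trans (small m hm) δ<½ε)))))
      in M , λ m n hm hn → ∣a-b∣<ε {q m} {q n} (near m n hm hn) (near n m hn hm)

  limit : ℝ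
  limit = mkℝ q q-cauchy

  limit-near : ∀ ε → 0ℚ ℚ.< ε →
    ∃[ M ] (limit ≤ʳ fromℚ (q M) +ℝ fromℚ ε × fromℚ (q M) ≤ʳ limit +ℝ fromℚ ε × u M ℚ.≤ ε)
  limit-near ε 0<ε =
    let M , close = q-cauchy ε 0<ε
        L , small = u-small ε 0<ε
        J = M ℕ.⊔ L
    in J , ≤-eventually (M , λ n hn → ℚ.<⇒≤ (a<b+ε {q n} {q J} (close n J hn (ℕ.m≤m⊔n M L))))
         , ≤-eventually (M , λ n hn → ℚ.<⇒≤ (a<b+ε {q J} {q n} (close J n (ℕ.m≤m⊔n M L) hn)))
         , small J (ℕ.m≤n⊔m M L)

  limit-lower : ∀ x → P x → limit ≤ʳ x
  limit-lower x Px = ≤-byε λ ε 0<ε → let M , limit≤ , _ , u≤ = limit-near (½ ℚ.* ε) (0<half 0<ε) in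
    ≤-trans limit≤ (≤-trans
      (+-monoˡ-≤ (fromℚ (½ ℚ.* ε)) (≤-trans (q-lower M x Px) (+-monoʳ-≤ x (fromℚ-mono-≤ u≤))))
      (≈⇒≤ (fromℚ-half+half x ε)))

  limit-greatest : ∀ l → (∀ x → P x → l ≤ʳ x) → l ≤ʳ limit
  limit-greatest l l≤P = ≤-byε λ ε 0<ε → let M , _ , ≤limit , u≤ = limit-near (½ ℚ.* ε) (0<half 0<ε) in
    ≤-trans (l≤P (p M) (p∈P M)) (≤-trans (p≤q M)
      (≤-trans (+-mono-≤ ≤limit (fromℚ-mono-≤ u≤)) (≈⇒≤ (fromℚ-half+half limit ε))))

  isInfimum : IsInfimum P limit
  isInfimum = (λ x Px → un≤ (limit-lower x Px)) , (λ l l≤P → un≤ (limit-greatest l λ x Px → mk≤ (l≤P x Px)))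

-- The values are rational, so they can be compared. The extra argument of type `Fin M` rules out an
-- empty domain.
argmin : ∀ {M} (f : Fin M → ℚ) → Fin M → ∃[ j ] (∀ i → f j ℚ.≤ f i)
argmin {suc zero}    f _ = zero , λ { zero → ℚ.≤-refl }
argmin {suc (suc M)} f _ with argmin {suc M} (f ∘ suc) zero
... | j , min with ℚ.≤-total (f zero) (f (suc j))
...   | inj₁ h = zero  , λ { zero → ℚ.≤-refl ; (suc i) → ℚ.≤-trans h (min i) }
...   | inj₂ h = suc j , λ { zero → h ; (suc i) → min i }

-- Density is measured one-sidedly and through `f` alone, which is all that an infimum of `f` sees
-- and requires no metric on `X`. The component `Fin M` records that the net is nonempty.
Net : {X : Set} (f : X → ℝ) → ℚ → Set
Net {X} f ε = ∃[ M ] Σ[ net ∈ (Fin M → X) ] (Fin M × (∀ x → ∃[ j ] (f (net j) ≤ʳ f x +ℝ fromℚ ε)))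

abstract
  -- Real values over the net cannot be compared exactly, so the smallest of their rational
  -- approximations is taken. Half of `ε` pays for the net, half for the approximation.
  approximate-minimum : {X : Set} (f : X → ℝ) → (∀ ε → 0ℚ ℚ.< ε → Net f ε) → ∀ ε → 0ℚ ℚ.< ε →
    ∃[ q ] ∃[ x ] ((∀ y → fromℚ q ≤ʳ f y +ℝ fromℚ ε) × f x ≤ʳ fromℚ q +ℝ fromℚ ε)
  approximate-minimum {X} f nets ε 0<ε = choose (nets δ 0<δ)
    where
    δ : ℚ
    δ = ½ ℚ.* ε

    0<δ : 0ℚ ℚ.< δ
    0<δ = 0<half 0<ε

    choose : Net f δ → ∃[ q ] ∃[ x ] ((∀ y → fromℚ q ≤ʳ f y +ℝ fromℚ ε) × f x ≤ʳ fromℚ q +ℝ fromℚ ε)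
    choose (M , net , j₀ , dense) = a j , net j , below , above
      where
      a : Fin M → ℚ
      a i = proj₁ (approx (f (net i)) δ 0<δ)

      j : Fin M
      j = proj₁ (argmin a j₀)

      below : ∀ y → fromℚ (a j) ≤ʳ f y +ℝ fromℚ ε
      below y = let i , near = dense y in
        ≤-trans (fromℚ-mono-≤ (proj₂ (argmin a j₀) i))
          (≤-trans (proj₂ (proj₂ (approx (f (net i)) δ 0<δ)))
            (≤-trans (+-monoˡ-≤ (fromℚ δ) near) (≈⇒≤ (fromℚ-half+half (f y) ε))))

      δ≤ε : δ ℚ.≤ ε
      δ≤ε = subst₂ ℚ._≤_ (ℚ.+-identityʳ δ) (half+half ε) (ℚ.+-monoʳ-≤ δ (ℚ.<⇒≤ 0<δ))

      above : f (net j) ≤ʳ fromℚ (a j) +ℝ fromℚ ε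
      above = ≤-trans (proj₁ (proj₂ (approx (f (net j)) δ 0<δ)))
        (≤-pointwise λ _ → ℚ.+-monoʳ-≤ (a j) δ≤ε)

infimum-from-nets : {X : Set} (f : X → ℝ) → (∀ ε → 0ℚ ℚ.< ε → Net f ε) →
  ∃ (IsInfimum (λ v → ∃[ x ] (f x ≈ℝ v)))
infimum-from-nets f nets = limit , isInfimum
  where
  min : ∀ n → ∃[ q ] ∃[ x ] ((∀ y → fromℚ q ≤ʳ f y +ℝ fromℚ (unit n)) × f x ≤ʳ fromℚ q +ℝ fromℚ (unit n))
  min n = approximate-minimum f nets (unit n) (0<unit n)

  lower : ∀ n y → ∃[ x ] (f x ≈ℝ y) → fromℚ (proj₁ (min n)) ≤ʳ y +ℝ fromℚ (unit n)
  lower n y (x , fx≈y) = ≤-trans (proj₁ (proj₂ (proj₂ (min n))) x) (+-monoˡ-≤ (fromℚ (unit n)) (≈⇒≤ (mk≈ fx≈y)))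

  open Infimum (λ v → ∃[ x ] (f x ≈ℝ v)) unit unit-small
    (λ n → proj₁ (min n))
    lower
    (λ n → f (proj₁ (proj₂ (min n))))
    (λ n → proj₁ (proj₂ (min n)) , un≈ (≈-refl {f (proj₁ (proj₂ (min n)))}))
    (λ n → proj₂ (proj₂ (proj₂ (min n))))

-- Finite nets in the unit interval and in the simplex.

module Grid (h : ℚ) (0<h : 0ℚ ℚ.< h) where

  private abstract
    0≤-sub : ∀ {p q} → p ℚ.≤ q → 0ℚ ℚ.≤ q ℚ.- p
    0≤-sub {p} {q} p≤q = subst (ℚ._≤ q ℚ.- p) (ℚ.+-inverseʳ p) (ℚ.+-monoˡ-≤ (ℚ.- p) p≤q)

    sub-≤ : ∀ {p q} → p ℚ.≤ h ℚ.+ q → p ℚ.- h ℚ.≤ q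
    sub-≤ {p} {q} le = subst (p ℚ.- h ℚ.≤_) (≡.trans (cong (ℚ._- h) (ℚ.+-comm h q)) (add-sub q h)) (ℚ.+-monoˡ-≤ (ℚ.- h) le)

    sub-sub : ∀ p q → p ℚ.- h ℚ.- q ≡ p ℚ.- (h ℚ.+ q)
    sub-sub p q = ≡.trans (ℚ.+-assoc p (ℚ.- h) (ℚ.- q)) (cong (p ℚ.+_) (≡.sym (ℚ.neg-distrib-+ h q)))

  multiple : ℕ → ℚ
  multiple zero    = 0ℚ
  multiple (suc m) = h ℚ.+ multiple m

  -- The multiple `(j + 1) h`. Leaving out 0 keeps every grid vector positive, so its coordinate sum
  -- can be inverted; numbers in `[0, h]` are rounded to `h`.
  point : ∀ {m} → Fin m → ℚ
  point zero    = h
  point (suc j) = h ℚ.+ point j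

  0<point : ∀ {m} (j : Fin m) → 0ℚ ℚ.< point j
  0<point zero    = 0<h
  0<point (suc j) = ℚ.+-mono-< 0<h (0<point j)

  nearest : ∀ m a → 0ℚ ℚ.≤ a → a ℚ.≤ multiple m → ∃[ j ] (ℚ.∣ a ℚ.- point {suc m} j ∣ ℚ.≤ h)
  nearest m a 0≤a a≤mh with ℚ.≤-total a h
  nearest m a 0≤a a≤mh | inj₁ a≤h = zero , (begin
    ℚ.∣ a ℚ.- h ∣     ≡⟨ ∣a-b∣≡∣b-a∣ a h ⟩
    ℚ.∣ h ℚ.- a ∣     ≡⟨ ℚ.0≤p⇒∣p∣≡p (0≤-sub a≤h) ⟩
    h ℚ.- a           ≤⟨ ℚ.+-monoʳ-≤ h (ℚ.neg-antimono-≤ 0≤a) ⟩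
    h ℚ.+ 0ℚ          ≡⟨ ℚ.+-identityʳ h ⟩
    h                 ∎)
    where open ℚ.≤-Reasoning
  nearest zero a 0≤a a≤0 | inj₂ h≤a = contradiction (ℚ.<-≤-trans 0<h (ℚ.≤-trans h≤a a≤0)) (ℚ.<-irrefl ≡.refl)
  nearest (suc m) a 0≤a a≤mh | inj₂ h≤a =
    let j , near = nearest m (a ℚ.- h) (0≤-sub h≤a) (sub-≤ a≤mh)
    in suc j , subst (λ t → ℚ.∣ t ∣ ℚ.≤ h) (sub-sub a (point j)) near

  -- If `h = (a + 1)/(d + 1)`, then `d + 1` steps reach `a + 1 ≥ 1`. The equation `p ≡ h` lets `go`
  -- match on a fraction although `h` is a module parameter.
  archimedean : ∃[ m ] (1ℚ ℚ.≤ multiple m)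
  archimedean = go h 0<h ≡.refl
    where
    fromℕ : ℕ → ℚ
    fromℕ m = mkℚ (ℤ.+ m) 0 (ℕ.sym (ℕ.1-coprimeTo m))

    fromℕ-suc : ∀ m → fromℕ (suc m) ≡ 1ℚ ℚ.+ fromℕ m
    fromℕ-suc m = ℚ.toℚᵘ-injective (ℚᵘ.≃-trans
      (ℚᵘ.*≡* (cong (λ t → (ℤ.+ 1 ℤ.+ t) ℤ.* ℤ.+ 1) (≡.sym (ℤ.*-identityʳ (ℤ.+ m)))))
      (ℚᵘ.≃-sym (ℚ.toℚᵘ-homo-+ 1ℚ (fromℕ m))))

    multiple≡ : ∀ m → multiple m ≡ fromℕ m ℚ.* h
    multiple≡ zero    = ≡.sym (ℚ.*-zeroˡ h)
    multiple≡ (suc m) = begin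
      h ℚ.+ multiple m               ≡⟨ cong₂ ℚ._+_ (≡.sym (ℚ.*-identityˡ h)) (multiple≡ m) ⟩
      1ℚ ℚ.* h ℚ.+ fromℕ m ℚ.* h     ≡⟨ ℚ.*-distribʳ-+ h 1ℚ (fromℕ m) ⟨
      (1ℚ ℚ.+ fromℕ m) ℚ.* h         ≡⟨ cong (ℚ._* h) (fromℕ-suc m) ⟨
      fromℕ (suc m) ℚ.* h            ∎
      where open ≡.≡-Reasoning

    go : ∀ p → 0ℚ ℚ.< p → p ≡ h → ∃[ m ] (1ℚ ℚ.≤ multiple m)
    go (mkℚ (ℤ.+ zero)  d _) (ℚ.*<* (ℤ.+<+ ()))
    go p@(mkℚ ℤ.+[1+ a ]  d _) _ p≡h = suc d ,
      subst (1ℚ ℚ.≤_) (≡.trans (cong (fromℕ (suc d) ℚ.*_) p≡h) (≡.sym (multiple≡ (suc d))))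
        (ℚ.toℚᵘ-cancel-≤ (ℚᵘ.≤-respʳ-≃ (ℚᵘ.≃-sym (ℚ.toℚᵘ-homo-* (fromℕ (suc d)) p))
          (ℚᵘ.*≤* (ℤ.+≤+ (subst₂ ℕ._≤_
            (cong suc (≡.sym (≡.trans (ℕ.+-identityʳ (d ℕ.+ 0)) (ℕ.+-identityʳ d))))
            (cong suc (≡.sym (ℕ.*-identityʳ (a ℕ.+ d ℕ.* suc a))))
            (ℕ.m≤m*n (suc d) (suc a)))))))
    go (mkℚ ℤ.-[1+ a ]  d _) (ℚ.*<* ())

∣x∣≤ : ∀ {x y} → x ≤ʳ y → -ℝ x ≤ʳ y → ∣ x ∣ℝ ≤ʳ y
∣x∣≤ {x} {y} (mk≤ h) (mk≤ g) = mk≤ λ ε 0<ε → eventually₂ (λ n → bound (seq x n) (seq y n ℚ.+ ε)) (h ε 0<ε) (g ε 0<ε)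
  where
  bound : ∀ p q → p ℚ.< q → ℚ.- p ℚ.< q → ℚ.∣ p ∣ ℚ.< q
  bound p q p<q -p<q with ℚ.∣p∣≡p∨∣p∣≡-p p
  ... | inj₁ eq = subst (ℚ._< q) (≡.sym eq) p<q
  ... | inj₂ eq = subst (ℚ._< q) (≡.sym eq) -p<q

module UnitInterval (h : ℚ) (0<h : 0ℚ ℚ.< h) where
  open Grid h 0<h

  -- One step beyond 1, because the rational that stands for `x` in `cover` may exceed `x` by `h`.
  size : ℕ
  size = suc (proj₁ archimedean)

  cover : ∀ x → 0ℝ ≤ʳ x → x ≤ʳ 1ℝ → ∃[ j ] (∣ x -ℝ fromℚ (point {suc size} j) ∣ℝ ≤ʳ fromℚ h +ℝ fromℚ h)
  cover x 0≤x x≤1 = choose (approx x (½ ℚ.* h) (0<half 0<h))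
    where
    δ : ℚ
    δ = ½ ℚ.* h
    choose : ∃[ a ] (x ≤ʳ fromℚ (a ℚ.+ δ) × fromℚ a ≤ʳ x +ℝ fromℚ δ) →
      ∃[ j ] (∣ x -ℝ fromℚ (point {suc size} j) ∣ℝ ≤ʳ fromℚ h +ℝ fromℚ h)
    choose (a , x≤b , a≤x+δ) =
      let j , near = nearest size b 0≤b b≤multiple in j , (begin
        ∣ x -ℝ fromℚ (point j) ∣ℝ
          ≈⟨ ∣∣-cong (solve 3 (λ x b p → x :- p := (x :- b) :+ (b :- p)) ≈-refl x (fromℚ b) (fromℚ (point j))) ⟩
        ∣ (x -ℝ fromℚ b) +ℝ (fromℚ b -ℝ fromℚ (point j)) ∣ℝ
          ≤⟨ ∣x+y∣≤∣x∣+∣y∣ (x -ℝ fromℚ b) (fromℚ b -ℝ fromℚ (point j)) ⟩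
        ∣ x -ℝ fromℚ b ∣ℝ +ℝ ∣ fromℚ b -ℝ fromℚ (point j) ∣ℝ
          ≤⟨ +-mono-≤ ∣x-b∣≤h (≤-pointwise λ _ → near) ⟩
        fromℚ h +ℝ fromℚ h ∎)
      where
      open ≤-Reasoning
      -- The approximation `a` could be negative. Shifted up by `δ` it lies between `x` and `x + h`,
      -- hence in the range of the grid; this shift and the rounding cost `h` each.
      b : ℚ
      b = a ℚ.+ δ

      b≤x+h : fromℚ b ≤ʳ x +ℝ fromℚ h
      b≤x+h = begin
        fromℚ b                           ≈⟨ ≈-pointwise (λ _ → ≡.refl) ⟩
        fromℚ a +ℝ fromℚ δ                ≤⟨ +-monoˡ-≤ (fromℚ δ) a≤x+δ ⟩
        x +ℝ fromℚ δ +ℝ fromℚ δ           ≈⟨ fromℚ-half+half x h ⟩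
        x +ℝ fromℚ h                      ∎

      0≤b : 0ℚ ℚ.≤ b
      0≤b = fromℚ-cancel-≤ (≤-trans 0≤x x≤b)

      b≤multiple : b ℚ.≤ multiple size
      b≤multiple = ℚ.≤-trans (fromℚ-cancel-≤ (begin
        fromℚ b                           ≤⟨ b≤x+h ⟩
        x +ℝ fromℚ h                      ≤⟨ +-monoˡ-≤ (fromℚ h) x≤1 ⟩
        1ℝ +ℝ fromℚ h                     ≈⟨ +-comm 1ℝ (fromℚ h) ⟩
        fromℚ h +ℝ 1ℝ                     ≈⟨ ≈-pointwise (λ _ → ≡.refl) ⟩
        fromℚ (h ℚ.+ 1ℚ)                  ∎)) (ℚ.+-monoʳ-≤ h (proj₂ archimedean))

      ∣x-b∣≤h : ∣ x -ℝ fromℚ b ∣ℝ ≤ʳ fromℚ h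
      ∣x-b∣≤h = ∣x∣≤
        (begin
          x -ℝ fromℚ b                    ≤⟨ +-monoˡ-≤ (-ℝ fromℚ b) x≤b ⟩
          fromℚ b -ℝ fromℚ b              ≈⟨ solve 1 (λ b → b :- b := con 0ℚ) ≈-refl (fromℚ b) ⟩
          0ℝ                              ≤⟨ fromℚ-mono-≤ (ℚ.<⇒≤ 0<h) ⟩
          fromℚ h                         ∎)
        (begin
          -ℝ (x -ℝ fromℚ b)               ≈⟨ solve 2 (λ x b → :- (x :- b) := b :- x) ≈-refl x (fromℚ b) ⟩
          fromℚ b -ℝ x                    ≤⟨ +-monoˡ-≤ (-ℝ x) b≤x+h ⟩
          x +ℝ fromℚ h -ℝ x               ≈⟨ solve 2 (λ x h → x :+ h :- x := h) ≈-refl x (fromℚ h) ⟩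
          fromℚ h                         ∎)

-- ‖y − y/Y‖₁ = |Y − 1| = |Σ (y − x)| ≤ ‖x − y‖₁ for x in the simplex and Y = Σ y.
module Normalise {k : ℕ} (y : Vector ℝ k) (0≤y : ∀ i → 0ℝ ≤ʳ y i)
  (s : ℝ) (0≤s : 0ℝ ≤ʳ s) (sY≈1 : s *ℝ sumℝ y ≈ 1ℝ) where

  s·y∈simplex : InSimplex (s ·ᵛ y)
  s·y∈simplex = (λ i → un≤ (0≤x*y 0≤s (0≤y i))) , un≈ (≈-trans (≈-sym (*-distribˡ-sum s y)) sY≈1)

  L₁-normalise : ∀ x → InSimplex x → L₁ (x -ᵛ (s ·ᵛ y)) ≤ʳ L₁ (x -ᵛ y) +ℝ L₁ (x -ᵛ y)
  L₁-normalise x (_ , Σx≈1) = ≤-trans (L₁-triangle x y (s ·ᵛ y)) (+-monoʳ-≤ (L₁ (x -ᵛ y)) (begin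
    sumℝ (λ i → ∣ y i -ℝ s *ℝ y i ∣ℝ)
      ≈⟨ sum-cong-≋ (λ i → begin-equality
           ∣ y i -ℝ s *ℝ y i ∣ℝ           ≈⟨ ∣∣-cong (solve 2 (λ y s → y :- s :* y := (con 1ℚ :- s) :* y) ≈-refl (y i) s) ⟩
           ∣ (1ℝ -ℝ s) *ℝ y i ∣ℝ          ≈⟨ ∣x*y∣≈∣x∣*∣y∣ (1ℝ -ℝ s) (y i) ⟩
           ∣ 1ℝ -ℝ s ∣ℝ *ℝ ∣ y i ∣ℝ       ≈⟨ *-congˡ (0≤x⇒∣x∣≈x (0≤y i)) ⟩
           ∣ 1ℝ -ℝ s ∣ℝ *ℝ y i            ∎) ⟩
    sumℝ (λ i → ∣ 1ℝ -ℝ s ∣ℝ *ℝ y i)      ≈⟨ *-distribˡ-sum ∣ 1ℝ -ℝ s ∣ℝ y ⟨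
    ∣ 1ℝ -ℝ s ∣ℝ *ℝ sumℝ y                ≈⟨ *-congˡ (0≤x⇒∣x∣≈x (0≤sum 0≤y)) ⟨
    ∣ 1ℝ -ℝ s ∣ℝ *ℝ ∣ sumℝ y ∣ℝ           ≈⟨ ∣x*y∣≈∣x∣*∣y∣ (1ℝ -ℝ s) (sumℝ y) ⟨
    ∣ (1ℝ -ℝ s) *ℝ sumℝ y ∣ℝ              ≈⟨ ∣∣-cong (solve 2 (λ s Y → (con 1ℚ :- s) :* Y := Y :- s :* Y) ≈-refl s (sumℝ y)) ⟩
    ∣ sumℝ y -ℝ s *ℝ sumℝ y ∣ℝ            ≈⟨ ∣∣-cong (+-congˡ (neg-cong (≈-trans sY≈1 (≈-sym (mk≈ Σx≈1))))) ⟩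
    ∣ sumℝ y -ℝ sumℝ x ∣ℝ                 ≈⟨ ∣∣-cong (sum-sub y x) ⟨
    ∣ sumℝ (y -ᵛ x) ∣ℝ                    ≤⟨ ∣sum∣≤L₁ (y -ᵛ x) ⟩
    L₁ (y -ᵛ x)                           ≈⟨ L₁-sym y x ⟩
    L₁ (x -ᵛ y)                           ∎))
    where open ≤-Reasoning

-- Grid vectors near the simplex are rescaled to coordinate sum 1. Rescaling at most doubles the
-- distance to a point of the simplex, so the grid has to be dense within `½ δ`. The vectors are
-- enumerated by coding their coordinate functions with `funToFin`.
simplex-net : ∀ k δ → 0ℚ ℚ.< δ → ∃[ M ] Σ[ net ∈ (Fin M → Vector ℝ (suc k)) ]
  (Fin M × (∀ j → InSimplex (net j)) × (∀ x → InSimplex x → ∃[ j ] (L₁ (x -ᵛ net j) ≤ʳ fromℚ δ)))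
simplex-net k δ 0<δ = M , net , funToFin {suc k} {suc size} (λ _ → zero) , net∈simplex , dense
  where
  threshold : ∃[ η ] (0ℚ ℚ.< η × (∀ (f : Vector ℝ (suc k)) → (∀ i → f i ≤ʳ fromℚ η) → sumℝ f ≤ʳ fromℚ (½ ℚ.* δ)))
  threshold = sum-small (suc k) (½ ℚ.* δ) (0<half 0<δ)

  -- `cover` leaves an error of `2h` in each coordinate; this is the threshold at which the errors
  -- add up to at most `½ δ`.
  h : ℚ
  h = ½ ℚ.* proj₁ threshold

  0<h : 0ℚ ℚ.< h
  0<h = 0<half (proj₁ (proj₂ threshold))

  open Grid h 0<h using (point; 0<point)
  open UnitInterval h 0<h

  M : ℕ
  M = suc size ℕ.^ suc k

  y : (Fin (suc k) → Fin (suc size)) → Vector ℝ (suc k)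
  y c i = fromℚ (point (c i))

  0≤y : ∀ c i → 0ℝ ≤ʳ y c i
  0≤y c i = fromℚ-mono-≤ (ℚ.<⇒≤ (0<point (c i)))

  scale : ∀ c → ∃[ s ] (0ℝ ≤ʳ s × s *ℝ sumℝ (y c) ≈ 1ℝ)
  scale c = invertible (ε≤x⇒0<x (0<point (c zero)) (term≤sum (0≤y c) zero))

  net : Fin M → Vector ℝ (suc k)
  net j = proj₁ (scale (finToFun j)) ·ᵛ y (finToFun j)

  module Net-point j = Normalise (y (finToFun j)) (0≤y (finToFun j))
    (proj₁ (scale (finToFun j))) (proj₁ (proj₂ (scale (finToFun j)))) (proj₂ (proj₂ (scale (finToFun j))))

  net∈simplex : ∀ j → InSimplex (net j)
  net∈simplex = Net-point.s·y∈simplex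

  dense : ∀ x → InSimplex x → ∃[ j ] (L₁ (x -ᵛ net j) ≤ʳ fromℚ δ)
  dense x x∈Δ@(0≤x , Σx≈1) = j , (begin
    L₁ (x -ᵛ net j)                                             ≤⟨ Net-point.L₁-normalise j x x∈Δ ⟩
    L₁ (x -ᵛ y (finToFun j)) +ℝ L₁ (x -ᵛ y (finToFun j))        ≤⟨ +-mono-≤ close close ⟩
    fromℚ (½ ℚ.* δ) +ℝ fromℚ (½ ℚ.* δ)                          ≈⟨ ≈-pointwise (λ _ → half+half δ) ⟩
    fromℚ δ                                                     ∎)
    where
    open ≤-Reasoning
    nearest-point : ∀ i → ∃[ c ] (∣ x i -ℝ fromℚ (point {suc size} c) ∣ℝ ≤ʳ fromℚ h +ℝ fromℚ h)
    nearest-point i = cover (x i) (mk≤ (0≤x i)) (≤-trans (term≤sum {f = x} (λ l → mk≤ (0≤x l)) i) (≈⇒≤ (mk≈ Σx≈1)))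

    c : Fin (suc k) → Fin (suc size)
    c i = proj₁ (nearest-point i)

    j : Fin M
    j = funToFin c

    close : L₁ (x -ᵛ y (finToFun j)) ≤ʳ fromℚ (½ ℚ.* δ)
    close = proj₂ (proj₂ threshold) _ λ i → begin
      ∣ x i -ℝ fromℚ (point (finToFun j i)) ∣ℝ    ≡⟨ cong (λ t → ∣ x i -ℝ fromℚ (point t) ∣ℝ) (Fin.finToFun-funToFin c i) ⟩
      ∣ x i -ℝ fromℚ (point (c i)) ∣ℝ             ≤⟨ proj₂ (nearest-point i) ⟩
      fromℚ h +ℝ fromℚ h                          ≈⟨ ≈-pointwise (λ _ → half+half (proj₁ threshold)) ⟩
      fromℚ (proj₁ threshold)                     ∎

-- Embeddings and the minimum volume.

vertex-diagonal : ∀ {k} (i : Fin k) → vertex i i ≡ 1ℝ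
vertex-diagonal i with i Fin.≟ i
... | yes _   = ≡.refl
... | no  i≢i = contradiction ≡.refl i≢i

vertex-off-diagonal : ∀ {k} {i j : Fin k} → i ≢ j → vertex i j ≡ 0ℝ
vertex-off-diagonal {i = i} {j} i≢j with i Fin.≟ j
... | yes i≡j = contradiction i≡j i≢j
... | no  _   = ≡.refl

0<N-edge : ∀ {k} {N : Vector ℝ k → ℝ} → IsNorm N → ∀ {i j} → i ≢ j → 0ℝ <ℝ N (vertex i -ᵛ vertex j)
0<N-edge isNorm {i} {j} i≢j = IsNorm.definite isNorm (vertex i -ᵛ vertex j) (i ,
  subst₂ (λ s t → 0ℝ <ℝ ∣ s -ℝ t ∣ℝ) (≡.sym (vertex-diagonal i)) (≡.sym (vertex-off-diagonal (i≢j ∘ ≡.sym)))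
    (fromℚ-mono-< {0ℚ} {1ℚ} (ℚ.positive⁻¹ 1ℚ)))

module Volume {k : ℕ} (G : Instance (suc k)) {N : Vector ℝ (suc k) → ℝ} (isNorm : IsNorm N) where
  open Instance G
  open Norm isNorm
  open Embedding

  edgeLength : Embedding G → Fin edges → ℝ
  edgeLength E e = N (φ E (proj₁ (ends e)) -ᵛ φ E (proj₂ (ends e)))

  0≤cost : ∀ e → 0ℝ ≤ʳ cost e
  0≤cost e = mk≤ (cost-nonNegative e)

  0≤cost*edgeLength : ∀ E e → 0ℝ ≤ʳ cost e *ℝ edgeLength E e
  0≤cost*edgeLength E e = 0≤x*y (0≤cost e) (0≤N _)

  0≤vol : ∀ (E : Embedding G) → 0ℝ ≤ʳ vol G N E
  0≤vol E = 0≤sum (0≤cost*edgeLength E)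

  vol-lipschitz : ∀ (E F : Embedding G) δ → (∀ u → L₁ (φ E u -ᵛ φ F u) ≤ʳ δ) →
    vol G N E ≤ʳ vol G N F +ℝ sumℝ cost *ℝ (fromℚ K *ℝ (δ +ℝ δ))
  vol-lipschitz E F δ close = begin
    vol G N E                                                      ≤⟨ sum-mono-≤ (λ e → *-monoʳ-≤ (cost e) (0≤cost e) (edge e)) ⟩
    sumℝ (λ e → cost e *ℝ (edgeLength F e +ℝ error))               ≈⟨ sum-cong-≋ (λ e → distribˡ (cost e) _ _) ⟩
    sumℝ (λ e → cost e *ℝ edgeLength F e +ℝ cost e *ℝ error)       ≈⟨ ∑-distrib-+ (λ e → cost e *ℝ edgeLength F e) (λ e → cost e *ℝ error) ⟩
    vol G N F +ℝ sumℝ (λ e → cost e *ℝ error)                      ≈⟨ +-congˡ (*-distribʳ-sum error cost) ⟨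
    vol G N F +ℝ sumℝ cost *ℝ error                                ∎
    where
    open ≤-Reasoning
    error : ℝ
    error = fromℚ K *ℝ (δ +ℝ δ)

    edge : ∀ e → edgeLength E e ≤ʳ edgeLength F e +ℝ error
    edge e = ≤-trans (N-lipschitz (φ E u -ᵛ φ E w) (φ F u -ᵛ φ F w))
      (+-monoʳ-≤ (edgeLength F e) (*-monoʳ-≤ (fromℚ K) 0≤K (begin
        L₁ ((φ E u -ᵛ φ E w) -ᵛ (φ F u -ᵛ φ F w))
          ≤⟨ sum-mono-≤ (λ i → begin
               ∣ (φ E u i -ℝ φ E w i) -ℝ (φ F u i -ℝ φ F w i) ∣ℝ
                 ≈⟨ ∣∣-cong (solve 4 (λ a b c d → (a :- b) :- (c :- d) := (a :- c) :+ (d :- b)) ≈-refl (φ E u i) (φ E w i) (φ F u i) (φ F w i)) ⟩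
               ∣ (φ E u i -ℝ φ F u i) +ℝ (φ F w i -ℝ φ E w i) ∣ℝ
                 ≤⟨ ∣x+y∣≤∣x∣+∣y∣ (φ E u i -ℝ φ F u i) (φ F w i -ℝ φ E w i) ⟩
               ∣ φ E u i -ℝ φ F u i ∣ℝ +ℝ ∣ φ F w i -ℝ φ E w i ∣ℝ ∎) ⟩
        sumℝ (λ i → ∣ φ E u i -ℝ φ F u i ∣ℝ +ℝ ∣ φ F w i -ℝ φ E w i ∣ℝ)
          ≈⟨ ∑-distrib-+ (λ i → ∣ φ E u i -ℝ φ F u i ∣ℝ) (λ i → ∣ φ F w i -ℝ φ E w i ∣ℝ) ⟩
        L₁ (φ E u -ᵛ φ F u) +ℝ L₁ (φ F w -ᵛ φ E w)
          ≤⟨ +-mono-≤ (close u) (≤-trans (≈⇒≤ (L₁-sym (φ F w) (φ E w))) (close w)) ⟩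
        δ +ℝ δ ∎)))
      where
      u w : Fin nodes
      u = proj₁ (ends e)
      w = proj₂ (ends e)

  -- Net points chosen node by node need not put terminals exactly at their vertices, so terminal
  -- nodes are overridden. Every embedding has them at the same vertices, so their distance to it
  -- becomes 0.
  module Place (ψ : Fin nodes → Vector ℝ (suc k)) (ψ∈simplex : ∀ u → InSimplex (ψ u)) where

    position : ∀ u → Dec (∃[ i ] (terminal i ≡ u)) → Vector ℝ (suc k)
    position u (yes (i , _)) = vertex i
    position u (no _)        = ψ u

    position∈simplex : ∀ u d → InSimplex (position u d)
    position∈simplex u (yes (i , _)) = vertex∈simplex i
    position∈simplex u (no _)        = ψ∈simplex u

    position-terminal : ∀ i d → position (terminal i) d ≈ᵛ vertex i
    position-terminal i (yes (j , eq)) with ≡.refl ← terminal-injective eq = λ l → un≈ (≈-refl {vertex i l})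
    position-terminal i (no ¬p)        = contradiction (i , ≡.refl) ¬p

    terminal? : ∀ u → Dec (∃[ i ] (terminal i ≡ u))
    terminal? u = Fin.any? (λ i → terminal i Fin.≟ u)

    embedding : Embedding G
    embedding = record
      { φ          = λ u → position u (terminal? u)
      ; φ-simplex  = λ u → position∈simplex u (terminal? u)
      ; φ-terminal = λ i → position-terminal i (terminal? (terminal i))
      }

    position-close : ∀ (E : Embedding G) {δ} → 0ℚ ℚ.≤ δ → ∀ u d → L₁ (φ E u -ᵛ ψ u) ≤ʳ fromℚ δ → L₁ (φ E u -ᵛ position u d) ≤ʳ fromℚ δ
    position-close E 0≤δ u (no _) close = close
    position-close E {δ} 0≤δ u (yes (i , ≡.refl)) _ = begin
      L₁ (φ E (terminal i) -ᵛ vertex i)   ≈⟨ sum-cong-≋ (λ l → begin-equality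
          ∣ φ E (terminal i) l -ℝ vertex i l ∣ℝ   ≈⟨ ∣∣-cong (+-congʳ (mk≈ (φ-terminal E i l))) ⟩
          ∣ vertex i l -ℝ vertex i l ∣ℝ           ≈⟨ ∣∣-cong (solve 1 (λ x → x :- x := con 0ℚ) ≈-refl (vertex i l)) ⟩
          ∣ 0ℝ ∣ℝ                                 ≈⟨ 0≤x⇒∣x∣≈x ≤-refl ⟩
          0ℝ                                      ∎) ⟩
      sumℝ {suc k} (λ _ → 0ℝ)             ≈⟨ sum-replicate-zero (suc k) ⟩
      0ℝ                                  ≤⟨ fromℚ-mono-≤ 0≤δ ⟩
      fromℚ δ                             ∎
      where open ≤-Reasoning

  embedding-net : ∀ δ → 0ℚ ℚ.< δ → ∃[ M ] Σ[ net ∈ (Fin M → Embedding G) ]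
    (Fin M × (∀ (E : Embedding G) → ∃[ j ] (∀ u → L₁ (φ E u -ᵛ φ (net j) u) ≤ʳ fromℚ δ)))
  embedding-net δ 0<δ = choose (simplex-net k δ 0<δ)
    where
    choose : (∃[ M ] Σ[ net ∈ (Fin M → Vector ℝ (suc k)) ]
        (Fin M × (∀ j → InSimplex (net j)) × (∀ x → InSimplex x → ∃[ j ] (L₁ (x -ᵛ net j) ≤ʳ fromℚ δ)))) →
      ∃[ M ] Σ[ net ∈ (Fin M → Embedding G) ] (Fin M × (∀ (E : Embedding G) → ∃[ j ] (∀ u → L₁ (φ E u -ᵛ φ (net j) u) ≤ʳ fromℚ δ)))
    choose (M , net , j₀ , net∈simplex , dense) =
      M ℕ.^ nodes , At.embedding , funToFin {nodes} {M} (λ _ → j₀) , λ E →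
        let c : Fin nodes → Fin M
            c u = proj₁ (dense (φ E u) (φ-simplex E u))
            j = funToFin c
        in j , λ u → At.position-close j E (ℚ.<⇒≤ 0<δ) u (At.terminal? j u)
          (subst (λ t → L₁ (φ E u -ᵛ net t) ≤ʳ fromℚ δ) (≡.sym (Fin.finToFun-funToFin c u)) (proj₂ (dense (φ E u) (φ-simplex E u))))
      where
      module At (j : Fin (M ℕ.^ nodes)) = Place (λ u → net (finToFun {M} {nodes} j u)) (λ u → net∈simplex (finToFun {M} {nodes} j u))

  minVolume : ∃ (IsMinVolume G N)
  minVolume = infimum-from-nets (vol G N) nets
    where
    nets : ∀ ε → 0ℚ ℚ.< ε → Net (vol G N) ε
    nets ε 0<ε = choose (upperBound (sumℝ cost))
      where
      open ≤-Reasoning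
      choose : ∃[ C ] (0ℚ ℚ.< C × sumℝ cost ≤ʳ fromℚ C) → Net (vol G N) ε
      choose (C , 0<C , cost≤C) = refine (divide D D-pos ε 0<ε)
        where
        -- Moving every node by at most `δ` in L₁ raises the volume by at most `C · K · 2δ`, which
        -- is `D δ = ε`.
        D : ℚ
        D = C ℚ.* (K ℚ.+ K)

        D-pos : ℚ.Positive D
        D-pos = ℚ.pos*pos⇒pos C {{ℚ.positive 0<C}} (K ℚ.+ K) {{ℚ.positive (ℚ.+-mono-< 0<K 0<K)}}

        refine : ∃[ δ ] (0ℚ ℚ.< δ × D ℚ.* δ ≡ ε) → Net (vol G N) ε
        refine (δ , 0<δ , Dδ≡ε) = let M , net , j₀ , dense = embedding-net δ 0<δ in
          M , net , j₀ , λ E → let j , close = dense E in j , (begin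
            vol G N (net j)
              ≤⟨ vol-lipschitz (net j) E (fromℚ δ) (λ u → ≤-trans (≈⇒≤ (L₁-sym (φ (net j) u) (φ E u))) (close u)) ⟩
            vol G N E +ℝ sumℝ cost *ℝ error
              ≤⟨ +-monoʳ-≤ (vol G N E) (*-monoˡ-≤ error 0≤error cost≤C) ⟩
            vol G N E +ℝ fromℚ C *ℝ error
              ≈⟨ +-congˡ (solve 3 (λ C K d → C :* (K :* (d :+ d)) := (C :* (K :+ K)) :* d) ≈-refl (fromℚ C) (fromℚ K) (fromℚ δ)) ⟩
            vol G N E +ℝ fromℚ C *ℝ (fromℚ K +ℝ fromℚ K) *ℝ fromℚ δ
              ≈⟨ +-congˡ (≈-pointwise λ _ → Dδ≡ε) ⟩
            vol G N E +ℝ fromℚ ε ∎)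
          where
          error : ℝ
          error = fromℚ K *ℝ (fromℚ δ +ℝ fromℚ δ)
          0≤error : 0ℝ ≤ʳ error
          0≤error = 0≤x*y 0≤K (≤-pointwise λ _ → ℚ.<⇒≤ (ℚ.+-mono-< 0<δ 0<δ))

-- The classes of the two ends of each edge that is not exempt are merged in turn.
merge-labels : ∀ {n m} {R : Fin n → Fin n → Set} {Exempt : Fin m → Set} → IsEquivalence R →
  (ends : Fin m → Fin n × Fin n) → (∀ e → R (proj₁ (ends e)) (proj₂ (ends e)) ⊎ Exempt e) →
  Σ[ f ∈ (Fin n → Fin n) ] ((∀ u w → f u ≡ f w → R u w) ×
    (∀ e → f (proj₁ (ends e)) ≡ f (proj₂ (ends e)) ⊎ Exempt e))
merge-labels {m = zero} isEq ends classify = id , (λ { u .u ≡.refl → IsEquivalence.refl isEq }) , λ ()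
merge-labels {n} {suc m} {R} {Exempt} isEq ends classify =
  extend (merge-labels isEq (ends ∘ suc) (classify ∘ suc)) (classify zero)
  where
  module R = IsEquivalence isEq
  a b : Fin n
  a = proj₁ (ends zero)
  b = proj₂ (ends zero)

  Good : (Fin n → Fin n) → Set
  Good f = (∀ u w → f u ≡ f w → R u w) × (∀ e → f (proj₁ (ends e)) ≡ f (proj₂ (ends e)) ⊎ Exempt e)

  extend : Σ[ f ∈ (Fin n → Fin n) ] ((∀ u w → f u ≡ f w → R u w) ×
      (∀ e → f (proj₁ (ends (suc e))) ≡ f (proj₂ (ends (suc e))) ⊎ Exempt (suc e))) →
    R a b ⊎ Exempt zero → ∃ Good
  extend (f , sound , covers) (inj₂ exempt) = f , sound , λ { zero → inj₂ exempt ; (suc e) → covers e }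
  extend (f , sound , covers) (inj₁ aRb) = relabel ∘ f , sound′ , covers′
    where
    relabel : Fin n → Fin n
    relabel l with l Fin.≟ f a
    ... | yes _ = f b
    ... | no  _ = l

    relabel-fa : relabel (f a) ≡ f b
    relabel-fa with f a Fin.≟ f a
    ... | yes _   = ≡.refl
    ... | no  a≢a = contradiction ≡.refl a≢a

    relabel-fb : relabel (f b) ≡ f b
    relabel-fb with f b Fin.≟ f a
    ... | yes _ = ≡.refl
    ... | no  _ = ≡.refl

    sound′ : ∀ u w → relabel (f u) ≡ relabel (f w) → R u w
    sound′ u w eq with f u Fin.≟ f a | f w Fin.≟ f a
    ... | yes p | yes q = sound u w (≡.trans p (≡.sym q))
    ... | yes p | no  _ = R.trans (sound u a p) (R.trans aRb (sound b w eq))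
    ... | no  _ | yes q = R.trans (sound u b eq) (R.trans (R.sym aRb) (sound a w (≡.sym q)))
    ... | no  _ | no  _ = sound u w eq

    covers′ : ∀ e → relabel (f (proj₁ (ends e))) ≡ relabel (f (proj₂ (ends e))) ⊎ Exempt e
    covers′ zero = inj₁ (≡.trans relabel-fa (≡.sym relabel-fb))
    covers′ (suc e) with covers e
    ... | inj₁ eq     = inj₁ (cong relabel eq)
    ... | inj₂ exempt = inj₂ exempt

-- Positivity of the minimum N-volume.

module Positive {k : ℕ} (G : Instance (suc k)) {N : Vector ℝ (suc k) → ℝ} (isNorm : IsNorm N) where
  open Instance G
  open Norm isNorm
  open Volume G isNorm
  open Embedding

  -- Stands in for being joined by a path of edges of positive cost. Constants add along a path, so
  -- an equivalence relation replaces the path itself; uniformity in `E` turns it into a lower bound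
  -- on all volumes.
  Controlled : Fin nodes → Fin nodes → Set
  Controlled u w = ∃[ C ] (0ℚ ℚ.< C × (∀ (E : Embedding G) → N (φ E u -ᵛ φ E w) ≤ʳ fromℚ C *ℝ vol G N E))

  controlled-isEquivalence : IsEquivalence Controlled
  controlled-isEquivalence = record
    { refl  = λ {u} → 1ℚ , ℚ.positive⁻¹ 1ℚ , λ E → begin
        N (φ E u -ᵛ φ E u)      ≈⟨ N-cong (λ i → solve 1 (λ x → x :- x := con 0ℚ) ≈-refl (φ E u i)) ⟩
        N (λ _ → 0ℝ)            ≈⟨ N-0 ⟩
        0ℝ                      ≤⟨ 0≤vol E ⟩
        vol G N E               ≈⟨ *-identityˡ (vol G N E) ⟨
        1ℝ *ℝ vol G N E         ∎
    ; sym   = λ { {u} {w} (C , 0<C , h) → C , 0<C , λ E → ≤-trans (≈⇒≤ (N-sym (φ E w) (φ E u))) (h E) }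
    ; trans = λ { {u} {w} {z} (C , 0<C , h) (D , 0<D , g) → C ℚ.+ D , ℚ.+-mono-< 0<C 0<D , λ E → begin
        N (φ E u -ᵛ φ E z)                                    ≤⟨ N-triangle (φ E u) (φ E w) (φ E z) ⟩
        N (φ E u -ᵛ φ E w) +ℝ N (φ E w -ᵛ φ E z)              ≤⟨ +-mono-≤ (h E) (g E) ⟩
        fromℚ C *ℝ vol G N E +ℝ fromℚ D *ℝ vol G N E          ≈⟨ distribʳ (vol G N E) (fromℚ C) (fromℚ D) ⟨
        (fromℚ C +ℝ fromℚ D) *ℝ vol G N E                     ≈⟨ *-congʳ (≈-pointwise λ _ → ≡.refl) ⟩
        fromℚ (C ℚ.+ D) *ℝ vol G N E                          ∎ }
    }
    where open ≤-Reasoning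

  -- The edge contributes at least `θ` times its length to the volume, and all other contributions
  -- are nonnegative; thus `C = 1/θ`.
  costly⇒controlled : ∀ {θ} → 0ℚ ℚ.< θ → ∀ e → fromℚ θ ≤ʳ cost e → Controlled (proj₁ (ends e)) (proj₂ (ends e))
  costly⇒controlled {θ} 0<θ e θ≤cost = choose (divide θ (ℚ.positive 0<θ) 1ℚ (ℚ.positive⁻¹ 1ℚ))
    where
    open ≤-Reasoning
    choose : ∃[ C ] (0ℚ ℚ.< C × θ ℚ.* C ≡ 1ℚ) → Controlled (proj₁ (ends e)) (proj₂ (ends e))
    choose (C , 0<C , θC≡1) = C , 0<C , λ E → begin
      edgeLength E e                               ≈⟨ *-identityˡ _ ⟨
      1ℝ *ℝ edgeLength E e                         ≈⟨ *-congʳ (≈-pointwise λ _ → θC≡1) ⟨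
      fromℚ θ *ℝ fromℚ C *ℝ edgeLength E e         ≈⟨ solve 3 (λ t c l → t :* c :* l := c :* (t :* l)) ≈-refl (fromℚ θ) (fromℚ C) (edgeLength E e) ⟩
      fromℚ C *ℝ (fromℚ θ *ℝ edgeLength E e)       ≤⟨ *-monoʳ-≤ (fromℚ C) (fromℚ-mono-≤ (ℚ.<⇒≤ 0<C)) (≤-trans
                                                        (*-monoˡ-≤ (edgeLength E e) (0≤N _) θ≤cost)
                                                        (term≤sum (0≤cost*edgeLength E) e)) ⟩
      fromℚ C *ℝ vol G N E                         ∎

  -- Terminals never move: `β ≤ N (eᵢ − eⱼ) ≤ C · vol` in every embedding, so `δ = β / C` works.
  controlled-terminals⇒vol-positive : ∀ {i j} → i ≢ j → Controlled (terminal i) (terminal j) →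
    ∃[ δ ] (0ℚ ℚ.< δ × (∀ (E : Embedding G) → fromℚ δ ≤ʳ vol G N E))
  controlled-terminals⇒vol-positive {i} {j} i≢j (C , 0<C , h) = choose (0<x⇒∃ε≤x {N (vertex i -ᵛ vertex j)} (0<N-edge isNorm i≢j))
    where
    open ≤-Reasoning
    choose : ∃[ β ] (0ℚ ℚ.< β × fromℚ β ≤ʳ N (vertex i -ᵛ vertex j)) → ∃[ δ ] (0ℚ ℚ.< δ × (∀ (E : Embedding G) → fromℚ δ ≤ʳ vol G N E))
    choose (β , 0<β , β≤N) = let δ , 0<δ , Cδ≡β = divide C (ℚ.positive 0<C) β 0<β in
      δ , 0<δ , λ E → *-cancelʳ-≤ {z = fromℚ C} (fromℚ-mono-< 0<C) (begin
        fromℚ δ *ℝ fromℚ C                              ≈⟨ *-comm (fromℚ δ) (fromℚ C) ⟩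
        fromℚ C *ℝ fromℚ δ                              ≈⟨ ≈-pointwise (λ _ → Cδ≡β) ⟩
        fromℚ β                                         ≤⟨ β≤N ⟩
        N (vertex i -ᵛ vertex j)                        ≈⟨ N-cong (λ l → +-cong (mk≈ (φ-terminal E i l)) (neg-cong (mk≈ (φ-terminal E j l)))) ⟨
        N (φ E (terminal i) -ᵛ φ E (terminal j))        ≤⟨ h E ⟩
        fromℚ C *ℝ vol G N E                            ≈⟨ *-comm _ _ ⟩
        vol G N E *ℝ fromℚ C                            ∎)

  -- No label is shared by two terminals, so a label can be sent to the vertex of its terminal. A
  -- label without terminal goes to `vertex zero`; any point of the simplex would do.
  module Separated (f : Fin nodes → Fin nodes) (f-separates : ∀ i j → f (terminal i) ≡ f (terminal j) → i ≡ j) where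

    position : ∀ l → Dec (∃[ i ] (f (terminal i) ≡ l)) → Vector ℝ (suc k)
    position l (yes (i , _)) = vertex i
    position l (no _)        = vertex zero

    position∈simplex : ∀ l d → InSimplex (position l d)
    position∈simplex l (yes (i , _)) = vertex∈simplex i
    position∈simplex l (no _)        = vertex∈simplex zero

    position-terminal : ∀ i d → position (f (terminal i)) d ≈ᵛ vertex i
    position-terminal i (yes (j , eq)) with ≡.refl ← f-separates j i eq = λ l → un≈ (≈-refl {vertex i l})
    position-terminal i (no ¬p)        = contradiction (i , ≡.refl) ¬p

    labelled? : ∀ l → Dec (∃[ i ] (f (terminal i) ≡ l))
    labelled? l = Fin.any? (λ i → f (terminal i) Fin.≟ l)

    embedding : Embedding G
    embedding = record
      { φ          = λ u → position (f u) (labelled? (f u))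
      ; φ-simplex  = λ u → position∈simplex (f u) (labelled? (f u))
      ; φ-terminal = λ i → position-terminal i (labelled? (f (terminal i)))
      }

    -- An edge within one label has length 0, and any other edge is cheap and has length at most 1,
    -- the `½L₁`-diameter of the simplex.
    term≤ : ∀ {η} → 0ℚ ℚ.≤ η → ∀ e → f (proj₁ (ends e)) ≡ f (proj₂ (ends e)) ⊎ cost e ≤ʳ fromℚ η →
      cost e *ℝ ½L₁ (φ embedding (proj₁ (ends e)) -ᵛ φ embedding (proj₂ (ends e))) ≤ʳ fromℚ η
    term≤ {η} 0≤η e (inj₁ eq) = begin
      cost e *ℝ ½L₁ (x (f (proj₁ (ends e))) -ᵛ x (f (proj₂ (ends e))))
        ≡⟨ cong (λ l → cost e *ℝ ½L₁ (x l -ᵛ x (f (proj₂ (ends e))))) eq ⟩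
      cost e *ℝ ½L₁ (y -ᵛ y)
        ≈⟨ *-congˡ (*-congˡ (sum-cong-≋ λ i → ≈-trans (∣∣-cong (solve 1 (λ x → x :- x := con 0ℚ) ≈-refl (y i))) (0≤x⇒∣x∣≈x ≤-refl))) ⟩
      cost e *ℝ (fromℚ ½ *ℝ sumℝ {suc k} (λ _ → 0ℝ))
        ≈⟨ *-congˡ (*-congˡ (sum-replicate-zero (suc k))) ⟩
      cost e *ℝ (fromℚ ½ *ℝ 0ℝ)
        ≈⟨ solve 1 (λ c → c :* (con ½ :* con 0ℚ) := con 0ℚ) ≈-refl (cost e) ⟩
      0ℝ
        ≤⟨ fromℚ-mono-≤ 0≤η ⟩
      fromℚ η ∎
      where
      open ≤-Reasoning
      x : Fin nodes → Vector ℝ (suc k)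
      x l = position l (labelled? l)
      y : Vector ℝ (suc k)
      y = x (f (proj₂ (ends e)))
    term≤ {η} 0≤η e (inj₂ cheap) = begin
      cost e *ℝ ½L₁ (φ embedding (proj₁ (ends e)) -ᵛ φ embedding (proj₂ (ends e)))
        ≤⟨ *-monoʳ-≤ (cost e) (0≤cost e) (½L₁≤1 (φ embedding (proj₁ (ends e))) (φ embedding (proj₂ (ends e))) (φ-simplex embedding (proj₁ (ends e))) (φ-simplex embedding (proj₂ (ends e)))) ⟩
      cost e *ℝ 1ℝ   ≈⟨ *-identityʳ (cost e) ⟩
      cost e         ≤⟨ cheap ⟩
      fromℚ η        ∎
      where open ≤-Reasoning

  -- If cheap edges alone separated the terminals, collapsing the classes of the
  -- other edges onto vertices would give an embedding of smaller ½L₁-volume.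
  vol-positive : ∀ ε → 0ℚ ℚ.< ε → (∀ (E : Embedding G) → fromℚ ε ≤ʳ vol G ½L₁ E) →
    ∃[ δ ] (0ℚ ℚ.< δ × (∀ (E : Embedding G) → fromℚ δ ≤ʳ vol G N E))
  -- The threshold `η` makes the collapsed embedding have `½L₁`-volume at most `½ ε`, strictly below
  -- the lower bound `ε`.
  vol-positive ε 0<ε ε≤vol = choose (sum-small edges (½ ℚ.* ε) (0<half 0<ε))
    where
    choose : ∃[ η ] (0ℚ ℚ.< η × (∀ (f : Vector ℝ edges) → (∀ i → f i ≤ʳ fromℚ η) → sumℝ f ≤ʳ fromℚ (½ ℚ.* ε))) →
      ∃[ δ ] (0ℚ ℚ.< δ × (∀ (E : Embedding G) → fromℚ δ ≤ʳ vol G N E))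
    choose (η , 0<η , small) = conclude (merge-labels controlled-isEquivalence ends classify)
      where
      classify : ∀ e → Controlled (proj₁ (ends e)) (proj₂ (ends e)) ⊎ cost e ≤ʳ fromℚ η
      -- Whether a cost is positive cannot be decided, but the overlapping alternatives `≤ η` and
      -- `≥ ½ η` can be told apart well enough.
      classify e with ≤-or-≥ (cost e) η 0<η
      ... | inj₁ cheap  = inj₂ cheap
      ... | inj₂ costly = inj₁ (costly⇒controlled (0<half 0<η) e costly)

      conclude : Σ[ f ∈ (Fin nodes → Fin nodes) ] ((∀ u w → f u ≡ f w → Controlled u w) ×
          (∀ e → f (proj₁ (ends e)) ≡ f (proj₂ (ends e)) ⊎ cost e ≤ʳ fromℚ η)) →
        ∃[ δ ] (0ℚ ℚ.< δ × (∀ (E : Embedding G) → fromℚ δ ≤ʳ vol G N E))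
      -- Equality of labels is decidable, unlike being joined by costly edges. So the search either
      -- finds two terminals controlled by one another or leads to the contradiction.
      conclude (f , sound , covers)
        with Fin.any? (λ i → Fin.any? (λ j → ¬? (i Fin.≟ j) ×-dec (f (terminal i) Fin.≟ f (terminal j))))
      ... | yes (i , j , i≢j , eq) = controlled-terminals⇒vol-positive i≢j (sound (terminal i) (terminal j) eq)
      ... | no  separated = contradiction
        (<-≤-trans {fromℚ (½ ℚ.* ε)} {fromℚ ε} (fromℚ-mono-< ½ε<ε)
          (≤-trans (ε≤vol embedding) (small _ λ e → term≤ (ℚ.<⇒≤ 0<η) e (covers e))))
        (<-irrefl {fromℚ (½ ℚ.* ε)})
        where
        f-separates : ∀ i j → f (terminal i) ≡ f (terminal j) → i ≡ j
        f-separates i j eq with i Fin.≟ j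
        ... | yes i≡j = i≡j
        ... | no  i≢j = contradiction (i , j , i≢j , eq) separated
        open Separated f f-separates
        ½ε<ε : ½ ℚ.* ε ℚ.< ε
        ½ε<ε = subst₂ ℚ._<_ (ℚ.+-identityʳ _) (half+half ε) (ℚ.+-monoʳ-< (½ ℚ.* ε) (0<half 0<ε))

-- The test instance with one edge between two terminals.

module SingleEdge {k : ℕ} {i j : Fin k} (i<j : i Fin.< j) where

  -- With all nodes terminal, every embedding is `vertex` up to `≈ᵛ`, so the volume is forced to be
  -- `N (eᵢ − eⱼ)`, while a cut has to pay 1 for the edge.
  single : Instance k
  single = record
    { nodes              = k
    ; edges              = 1
    ; ends               = λ _ → i , j
    ; ends-ordered       = λ _ → i<j
    ; ends-injective     = λ { {zero} {zero} _ → ≡.refl }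
    ; cost               = λ _ → 1ℝ
    ; cost-nonNegative   = λ _ → un≤ (fromℚ-mono-≤ (ℚ.nonNegative⁻¹ 1ℚ))
    ; terminal           = id
    ; terminal-injective = id
    }

  minCut : IsMinCutCost single 1ℝ
  minCut = (inside ∷ [] , isCut , un≈ (+-identityʳ 1ℝ)) , lower
    where
    isCut : IsCut single (inside ∷ [])
    -- No edge survives the cut, so connectedness folds down to equality of nodes.
    isCut a b a≢b connected = a≢b (EqClosure.fold ≡.isEquivalence
      (λ { (zero , e∉S , _) → contradiction here e∉S }) connected)

    lower : ∀ c → CutCosts single c → 1ℝ ≤ℝ c
    lower c (inside ∷ [] , _ , cost≈c) = un≤ {1ℝ} {c} (≈⇒≤ (≈-trans (≈-sym (+-identityʳ 1ℝ)) (mk≈ cost≈c)))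
    lower c (outside ∷ [] , isCut , _) = contradiction
      (EqClosure.return (zero , (λ ()) , ≡.refl))
      (isCut i j λ { ≡.refl → contradiction ≡.refl (Fin.<⇒≢ i<j) })

  module _ {N : Vector ℝ k → ℝ} (isNorm : IsNorm N) where
    open Norm isNorm
    open Embedding

    vol≈ : ∀ (E : Embedding single) → vol single N E ≈ N (vertex i -ᵛ vertex j)
    vol≈ E = begin-equality
      1ℝ *ℝ N (φ E i -ᵛ φ E j) +ℝ 0ℝ    ≈⟨ solve 1 (λ x → con 1ℚ :* x :+ con 0ℚ := x) ≈-refl (N (φ E i -ᵛ φ E j)) ⟩
      N (φ E i -ᵛ φ E j)                ≈⟨ N-cong (λ l → +-cong (mk≈ (φ-terminal E i l)) (neg-cong (mk≈ (φ-terminal E j l)))) ⟩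
      N (vertex i -ᵛ vertex j)          ∎
      where open ≤-Reasoning

    standard : Embedding single
    standard = record { φ = vertex ; φ-simplex = vertex∈simplex ; φ-terminal = λ a l → un≈ (≈-refl {vertex a l}) }

    minVol : IsMinVolume single N (N (vertex i -ᵛ vertex j))
    minVol = (λ { x (E , vol≈x) → un≤ {N (vertex i -ᵛ vertex j)} {x} (≈⇒≤ (≈-trans (≈-sym (vol≈ E)) (mk≈ vol≈x))) })
           , (λ l l≤ → l≤ (N (vertex i -ᵛ vertex j)) (standard , un≈ (vol≈ standard)))

-- Edges are stored with increasing ends, so for `j < i` the instance for `j` and `i` is used
-- together with the symmetry of `N`.
relaxation⇒N-edge≤1 : ∀ {k} {N : Vector ℝ k → ℝ} → IsNorm N → IsRelaxation N →
  ∀ i j → N (vertex i -ᵛ vertex j) ≤ʳ 1ℝ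
relaxation⇒N-edge≤1 {k} {N} isNorm relaxation i j with Fin.<-cmp i j
... | tri< i<j _ _ = mk≤ (relaxation single (N (vertex i -ᵛ vertex j)) 1ℝ (minVol isNorm) minCut)
  where open SingleEdge i<j
... | tri> _ _ j<i = ≤-trans (≈⇒≤ (Norm.N-sym isNorm (vertex i) (vertex j)))
    (mk≤ (relaxation single (N (vertex j -ᵛ vertex i)) 1ℝ (minVol isNorm) minCut))
  where open SingleEdge j<i
... | tri≈ _ ≡.refl _ = begin
    N (vertex i -ᵛ vertex i)   ≈⟨ N-cong (λ l → solve 1 (λ x → x :- x := con 0ℚ) ≈-refl (vertex i l)) ⟩
    N (λ _ → 0ℝ)               ≈⟨ N-0 ⟩
    0ℝ                         ≤⟨ fromℚ-mono-≤ (ℚ.nonNegative⁻¹ 1ℚ) ⟩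
    1ℝ                         ∎
  where
  open ≤-Reasoning
  open Norm isNorm

-- Comparison of the ratios of one instance.

0≤cutCost : ∀ {k} (G : Instance k) S → 0ℝ ≤ʳ cutCost G S
0≤cutCost G S = 0≤sum λ e → nonNeg (lookup S e) (mk≤ (Instance.cost-nonNegative G e))
  where
  nonNeg : ∀ b {x} → 0ℝ ≤ʳ x → 0ℝ ≤ʳ (if b then x else 0ℝ)
  nonNeg true  0≤x = 0≤x
  nonNeg false _   = ≤-refl

module _ {k : ℕ} (G : Instance (suc k)) {N : Vector ℝ (suc k) → ℝ} (isNorm : IsNorm N)
  (N-edge≤1 : ∀ i j → N (vertex i -ᵛ vertex j) ≤ʳ 1ℝ) where
  open Instance G
  open Embedding
  open Norm isNorm
  open Volume G isNorm

  vol≤½L₁-vol : ∀ (E : Embedding G) → vol G N E ≤ʳ vol G ½L₁ E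
  vol≤½L₁-vol E = sum-mono-≤ λ e → *-monoʳ-≤ (cost e) (0≤cost e)
    (N≤½L₁ N-edge≤1 (φ E (proj₁ (ends e)) -ᵛ φ E (proj₂ (ends e)))
      (simplex-sum-sub (φ E (proj₁ (ends e))) (φ E (proj₂ (ends e)))
        (φ-simplex E (proj₁ (ends e))) (φ-simplex E (proj₂ (ends e)))))

  -- The minimum cut does not depend on the norm, so only the denominator changes: `s = c / w` for
  -- the minimum N-volume `w ≤ v`.
  larger-ratio : ∀ {c v r} → IsMinCutCost G c → IsMinVolume G ½L₁ v → 0ℝ <ℝ v → r *ℝ v ≈ c →
    ∃[ s ] (Ratios N s × r ≤ʳ s)
  larger-ratio {c} {v} {r} minCut@((S , _ , cost≈c) , _) (v-lower , v-greatest) 0<v rv≈c = choose minVolume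
    where
    open ≤-Reasoning

    v≤vol : ∀ (E : Embedding G) → v ≤ʳ vol G ½L₁ E
    v≤vol E = mk≤ (v-lower (vol G ½L₁ E) (E , un≈ (≈-refl {vol G ½L₁ E})))

    -- The sign is required to multiply `w ≤ v` by `r`; it comes from the nonnegative cost of the
    -- minimum cut.
    0≤r : 0ℝ ≤ʳ r
    0≤r = *-cancelʳ-≤ {z = v} 0<v (begin
      0ℝ *ℝ v       ≈⟨ zeroˡ v ⟩
      0ℝ            ≤⟨ 0≤cutCost G S ⟩
      cutCost G S   ≈⟨ mk≈ cost≈c ⟩
      c             ≈⟨ rv≈c ⟨
      r *ℝ v        ∎)

    vol-bounded-below : ∃[ δ ] (0ℚ ℚ.< δ × (∀ (E : Embedding G) → fromℚ δ ≤ʳ vol G N E))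
    vol-bounded-below = let ε , 0<ε , ε≤v = 0<x⇒∃ε≤x {v} 0<v in
      Positive.vol-positive G isNorm ε 0<ε (λ E → ≤-trans ε≤v (v≤vol E))

    choose : ∃ (IsMinVolume G N) → ∃[ s ] (Ratios N s × r ≤ʳ s)
    choose (w , isMin@(w-lower , w-greatest)) = divideBy (invertible {w} 0<w)
      where
      w≤v : w ≤ʳ v
      w≤v = mk≤ (v-greatest w λ { x (E , vol≈x) → un≤ (begin
        w            ≤⟨ mk≤ (w-lower (vol G N E) (E , un≈ (≈-refl {vol G N E}))) ⟩
        vol G N E    ≤⟨ vol≤½L₁-vol E ⟩
        vol G ½L₁ E  ≈⟨ mk≈ vol≈x ⟩
        x            ∎) })

      0<w : 0ℝ <ℝ w
      0<w = let δ , 0<δ , δ≤vol = vol-bounded-below in ε≤x⇒0<x {w} 0<δ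
        (mk≤ (w-greatest (fromℚ δ) λ { x (E , vol≈x) → un≤ {fromℚ δ} {x} (≤-trans (δ≤vol E) (≈⇒≤ (mk≈ vol≈x))) }))

      divideBy : ∃[ t ] (0ℝ ≤ʳ t × t *ℝ w ≈ 1ℝ) → ∃[ s ] (Ratios N s × r ≤ʳ s)
      divideBy (t , _ , tw≈1) = c *ℝ t , (G , c , w , minCut , isMin , 0<w , un≈ ctw≈c) ,
        *-cancelʳ-≤ {z = w} 0<w (begin
          r *ℝ w         ≤⟨ *-monoʳ-≤ r 0≤r w≤v ⟩
          r *ℝ v         ≈⟨ rv≈c ⟩
          c              ≈⟨ ctw≈c ⟨
          c *ℝ t *ℝ w    ∎)
        where
        ctw≈c : c *ℝ t *ℝ w ≈ c
        ctw≈c = begin-equality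
          c *ℝ t *ℝ w      ≈⟨ *-assoc c t w ⟩
          c *ℝ (t *ℝ w)    ≈⟨ *-congˡ tw≈1 ⟩
          c *ℝ 1ℝ          ≈⟨ *-identityʳ c ⟩
          c                ∎

lemma2p6 : (k : ℕ) → 3 ≤ k → (N : Vector ℝ k → ℝ) → IsNorm N → IsRelaxation N → integralityGap (½L₁ {k}) ≤∞ integralityGap N
lemma2p6 (suc k) _ N isNorm relaxation q (r , (G , c , v , minCut , minVol , 0<v , rv≈c) , q<r) =
  -- A rational below the supremum comes with a ratio `r` above it, so it is enough to dominate each
  -- ratio by one of `N`.
  let s , ratio , r≤s = larger-ratio G isNorm (relaxation⇒N-edge≤1 isNorm relaxation) {c} {v} {r} minCut minVol 0<v (mk≈ rv≈c)
  in s , ratio , <-≤-trans {fromℚ q} {r} q<r r≤s
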